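{- For every integer $n\ge 2$ we have $h(n)=h_k(n)$, where $k=k(n)$ is the integer defined by $\sigma_k\le n<\sigma_{k+1}$.
   Context: Let $p_i$ denote the $i$-th prime ($p_1=2$). Set $\sigma_0=0$ and $\sigma_j=p_1+p_2+\dots+p_j$ for $j\ge1$. For a squarefree positive integer $M$, $\ell(M)$ denotes the sum of the prime factors of $M$ (with $\ell(1)=0$) and $\omega(M)$ the number of prime factors of $M$. For an integer $n\ge0$, $h(n)$ is the maximum of all squarefree positive integers $M$ with $\ell(M)\le n$, i.e. the greatest product of a family of distinct primes whose sum does not exceed $n$ (so $h(0)=h(1)=1$). For $0\le j\le k(n)$ (equivalently $n\ge\sigma_j$), $h_j(n)$ is the maximum of all squarefree positive integers $M$ with $\omega(M)=j$ and $\ell(M)\le n$. -}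

module Defs where

open import Data.List using (List; []; _∷_; length)
open import Data.List.Membership.Propositional using (_∈_)
open import Data.List.Relation.Unary.All as All using (All; []; _∷_)
open import Data.List.Relation.Unary.AllPairs using ([]; _∷_)
open import Data.List.Relation.Unary.Unique.Propositional using (Unique)
open import Data.List.Relation.Binary.Permutation.Propositional.Properties using (↭-length)
open import Data.Nat using (ℕ; zero; suc; _+_; _*_; _^_; _!; _≤_; _<_; z≤n; s≤s; NonZero; >-nonZero)
open import Data.Nat.Coprimality using (Coprime; coprime-divisor)
open import Data.Nat.Divisibility
open import Data.Nat.ListAction using (sum; product)
open import Data.Nat.ListAction.Properties using (sum-↭)
open import Data.Nat.Primality
open import Data.Nat.Primality.Factorisation using (PrimeFactorisation; factors; factorise; factorisationUnique; factorisationHasAllPrimeFactors)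
open import Data.Nat.Properties
open import Data.Product using (∃; _×_; _,_; proj₁; proj₂)
open import Data.Sum using (inj₁; inj₂)
open import Function using (_∘_)
open import Level using (0ℓ)
open import Relation.Binary.PropositionalEquality using (_≡_; refl; sym; trans; cong; subst)
open import Relation.Nullary using (¬_; Dec; yes; no; contradiction)
open import Relation.Nullary.Decidable using (map′; _×-dec_; _→-dec_)
open import Relation.Unary using (Pred; Decidable)

open PrimeFactorisation using (isFactorisation; factorsPrime)

IsLeast : Pred ℕ 0ℓ → Pred ℕ 0ℓ
IsLeast P m = P m × (∀ x → P x → m ≤ x)

IsGreatest : Pred ℕ 0ℓ → Pred ℕ 0ℓ
IsGreatest P m = P m × (∀ x → P x → x ≤ m)

least : {P : Pred ℕ 0ℓ} → Decidable P → ∃ P → ∃ (IsLeast P)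
least {P} P? (x , Px) = go P? x Px
  where
  go : {P : Pred ℕ 0ℓ} → Decidable P → ∀ x → P x → ∃ (IsLeast P)
  go P? x Px with P? 0
  go P? x       Px | yes P0 = 0 , P0 , λ _ _ → z≤n
  go P? zero    Px | no ¬P0 = contradiction Px ¬P0
  go P? (suc x) Px | no ¬P0 with go (P? ∘ suc) x Px
  ... | m , Pm , m≤ = suc m , Pm , λ
    { zero    P0 → contradiction P0 ¬P0
    ; (suc y) Py → s≤s (m≤ y Py)
    }

greatest : {P : Pred ℕ 0ℓ} → Decidable P → ∃ P →
           ∀ b → (∀ x → P x → x ≤ b) → ∃ (IsGreatest P)
greatest P? (x , Px) b ≤b with P? b
greatest P? (x , Px) b       ≤b | yes Pb = b , Pb , ≤b
greatest {P} P? (x , Px) zero ≤b | no ¬Pb =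
  contradiction (subst P (n≤0⇒n≡0 (≤b x Px)) Px) ¬Pb
greatest {P} P? (x , Px) (suc b) ≤b | no ¬Pb =
  greatest P? (x , Px) b λ y Py →
    ≤-pred (≤∧≢⇒< (≤b y Py) λ y≡b → ¬Pb (subst P y≡b Py))

∣! : ∀ {q n} → .{{NonZero q}} → q ≤ n → q ∣ n !
∣! {suc q} q≤n = ∣-trans (m∣m*n (q !)) (m≤n⇒m!∣n! q≤n)

primeDivisor : ∀ n → 1 < n → ∃ λ q → Prime q × q ∣ n
primeDivisor n 1<n with factorise n {{>-nonZero (<-trans (s≤s z≤n) 1<n)}}
... | record { factors = [] ; isFactorisation = n≡1 } =
  contradiction (sym n≡1) (<⇒≢ 1<n)
... | record { factors = q ∷ qs ; isFactorisation = n≡ ; factorsPrime = q-prime ∷ _ } =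
  q , q-prime , subst (q ∣_) (sym n≡) (m∣m*n (product qs))

PrimeAbove : ℕ → Pred ℕ 0ℓ
PrimeAbove m q = m < q × Prime q

primeAbove-exists : ∀ m → ∃ (PrimeAbove m)
primeAbove-exists m with primeDivisor (suc (m !)) (s≤s (1≤n! m))
... | q , q-prime , q∣ with m <? q
...   | yes m<q = q , m<q , q-prime
...   | no  m≮q = contradiction (subst Prime (∣1⇒≡1 q∣1) q-prime) ¬prime[1]
  where
  instance
    q-nonZero : NonZero q
    q-nonZero = prime⇒nonZero q-prime
  q∣1 : q ∣ 1
  q∣1 = ∣m+n∣m⇒∣n (subst (q ∣_) (+-comm 1 (m !)) q∣) (∣! (≮⇒≥ m≮q))

nextPrime : ∀ m → ∃ (IsLeast (PrimeAbove m))
nextPrime m = least (λ q → m <? q ×-dec prime? q) (primeAbove-exists m)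

-- The primes are indexed from 1, so p 1 ≡ 2; the value at 0 only serves to
-- start the recursion.
p : ℕ → ℕ
p zero    = 0
p (suc i) = proj₁ (nextPrime (p i))

σ : ℕ → ℕ
σ zero    = 0
σ (suc j) = σ j + p (suc j)

p-< : ∀ i → p i < p (suc i)
p-< i = proj₁ (proj₁ (proj₂ (nextPrime (p i))))

p-prime : ∀ i → Prime (p (suc i))
p-prime i = proj₂ (proj₁ (proj₂ (nextPrime (p i))))

σ-< : ∀ j → σ j < σ (suc j)
σ-< j = m<m+n (σ j) (≤-<-trans z≤n (p-< j))

k-exists : ∀ n → ∃ λ k → σ k ≤ n × n < σ (suc k)
k-exists zero = 0 , z≤n , σ-< 0
k-exists (suc n) with k-exists n
... | k , σk≤n , n<σ with suc n <? σ (suc k)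
...   | yes sn<σ = k , m≤n⇒m≤1+n σk≤n , sn<σ
...   | no  sn≮σ = suc k , ≮⇒≥ sn≮σ , ≤-<-trans n<σ (σ-< (suc k))

Squarefree : Pred ℕ 0ℓ
Squarefree M = ∀ d → d * d ∣ M → d ≡ 1

-- The factors of a factorisation are listed with multiplicity.  ℓ and ω are
-- only applied to squarefree numbers, whose prime factors are all simple.
ℓ : (M : ℕ) → .{{NonZero M}} → ℕ
ℓ M = sum (factors (factorise M))

ω : (M : ℕ) → .{{NonZero M}} → ℕ
ω M = length (factors (factorise M))

squarefree? : ∀ M → .{{NonZero M}} → Dec (Squarefree M)
squarefree? M = map′
  (λ f d d²∣M → f (s≤s (∣⇒≤ (∣-trans (m∣m*n d) d²∣M))) d²∣M)
  (λ sf {d} _ → sf d)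
  (allUpTo? (λ d → (d * d ∣? M) →-dec (d ≟ 1)) (suc M))

record Admissible (n M : ℕ) : Set where
  constructor admissible
  field
    {{nonZero}} : NonZero M
    squarefree  : Squarefree M
    ℓ≤n         : ℓ M ≤ n

record Admissible[_] (j n M : ℕ) : Set where
  constructor admissible
  field
    {{nonZero}} : NonZero M
    squarefree  : Squarefree M
    ω≡j         : ω M ≡ j
    ℓ≤n         : ℓ M ≤ n

admissible? : ∀ n → Decidable (Admissible n)
admissible? n zero        = no λ { (admissible {{()}} _ _) }
admissible? n M@(suc _) = map′
  (λ (sf , ℓ≤n) → admissible sf ℓ≤n)
  (λ (admissible sf ℓ≤n) → sf , ℓ≤n)
  (squarefree? M ×-dec (ℓ M ≤? n))

admissible[_]? : ∀ j n → Decidable (Admissible[ j ] n)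
admissible[ j ]? n zero      = no λ { (admissible {{()}} _ _ _) }
admissible[ j ]? n M@(suc _) = map′
  (λ (sf , ω≡j , ℓ≤n) → admissible sf ω≡j ℓ≤n)
  (λ (admissible sf ω≡j ℓ≤n) → sf , ω≡j , ℓ≤n)
  (squarefree? M ×-dec (ω M ≟ j) ×-dec (ℓ M ≤? n))

n≤2^n : ∀ n → n ≤ 2 ^ n
n≤2^n zero    = z≤n
n≤2^n (suc n) = +-mono-≤ (m^n>0 2 n) (≤-trans (n≤2^n n) (m≤m+n (2 ^ n) 0))

product≤2^sum : ∀ ns → product ns ≤ 2 ^ sum ns
product≤2^sum []       = ≤-refl
product≤2^sum (n ∷ ns) = begin
  n * product ns      ≤⟨ *-mono-≤ (n≤2^n n) (product≤2^sum ns) ⟩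
  2 ^ n * 2 ^ sum ns  ≡⟨ ^-distribˡ-+-* 2 n (sum ns) ⟨
  2 ^ (n + sum ns)    ∎
  where open ≤-Reasoning

M≤2^ℓ : ∀ M → .{{_ : NonZero M}} → M ≤ 2 ^ ℓ M
M≤2^ℓ M = subst (_≤ 2 ^ ℓ M) (sym (isFactorisation (factorise M)))
                (product≤2^sum (factors (factorise M)))

admissible-bound : ∀ n M → Admissible n M → M ≤ 2 ^ n
admissible-bound n M (admissible _ ℓ≤n) = ≤-trans (M≤2^ℓ M) (^-monoʳ-≤ 2 ℓ≤n)

admissible[_]-bound : ∀ j n M → Admissible[ j ] n M → M ≤ 2 ^ n
admissible[ j ]-bound n M (admissible _ _ ℓ≤n) = ≤-trans (M≤2^ℓ M) (^-monoʳ-≤ 2 ℓ≤n)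

prime∣prime : ∀ {q r} → Prime q → Prime r → q ∣ r → q ≡ r
prime∣prime q-prime r-prime q∣r with prime⇒irreducible r-prime q∣r
... | inj₁ refl = contradiction q-prime ¬prime[1]
... | inj₂ q≡r  = q≡r

prime²∤product : ∀ {q qs} → Prime q → All Prime qs → Unique qs → ¬ (q * q ∣ product qs)
prime²∤product {q} {[]} q-prime _ _ q²∣1 =
  ¬prime[1] (subst Prime (∣1⇒≡1 (∣-trans (m∣m*n q) q²∣1)) q-prime)
prime²∤product {q} {r ∷ qs} q-prime (r-prime ∷ qs-prime) (r∉qs ∷ qs-unique) q²∣ with q ≟ r
... | yes refl = All.lookup r∉qs q∈qs refl
  where
  q∈qs : q ∈ qs
  q∈qs = factorisationHasAllPrimeFactors q-prime
    (*-cancelˡ-∣ q {{prime⇒nonZero q-prime}} q²∣) qs-prime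
... | no q≢r = prime²∤product q-prime qs-prime qs-unique (coprime-divisor coprime q²∣)
  where
  coprime : Coprime (q * q) r
  coprime {i} (i∣q² , i∣r) with prime⇒irreducible r-prime i∣r
  ... | inj₁ i≡1 = i≡1
  ... | inj₂ refl with euclidsLemma q q r-prime i∣q²
  ...   | inj₁ r∣q = contradiction (sym (prime∣prime r-prime q-prime r∣q)) q≢r
  ...   | inj₂ r∣q = contradiction (sym (prime∣prime r-prime q-prime r∣q)) q≢r

product-squarefree : ∀ {qs} → All Prime qs → Unique qs → Squarefree (product qs)
product-squarefree {qs} qs-prime qs-unique zero 0∣ =
  contradiction (0∣⇒≡0 0∣) λ eq → <⇒≢ (productOfPrimes≥1 qs-prime) (sym eq)
product-squarefree _ _ (suc zero) _ = refl
product-squarefree qs-prime qs-unique d@(suc (suc _)) d²∣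
  with primeDivisor d (s≤s (s≤s z≤n))
... | q , q-prime , q∣d =
  contradiction (∣-trans (*-pres-∣ q∣d q∣d) d²∣)
                (prime²∤product q-prime qs-prime qs-unique)

product-admissible : ∀ {qs} → All Prime qs → Unique qs →
                     Admissible[ length qs ] (sum qs) (product qs)
product-admissible {qs} qs-prime qs-unique =
  admissible (product-squarefree qs-prime qs-unique)
             (↭-length perm) (≤-reflexive (sum-↭ perm))
  where
  instance
    product-nonZero : NonZero (product qs)
    product-nonZero = >-nonZero (productOfPrimes≥1 qs-prime)
  perm = factorisationUnique (factorise (product qs))
    (record { factors = qs ; isFactorisation = refl ; factorsPrime = qs-prime })

firstPrimes : ℕ → List ℕ
firstPrimes zero    = []
firstPrimes (suc j) = p (suc j) ∷ firstPrimes j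

firstPrimes-prime : ∀ j → All Prime (firstPrimes j)
firstPrimes-prime zero    = []
firstPrimes-prime (suc j) = p-prime j ∷ firstPrimes-prime j

firstPrimes-≤ : ∀ j → All (_≤ p j) (firstPrimes j)
firstPrimes-≤ zero    = []
firstPrimes-≤ (suc j) = ≤-refl ∷ All.map (λ q≤ → ≤-trans q≤ (<⇒≤ (p-< j))) (firstPrimes-≤ j)

firstPrimes-unique : ∀ j → Unique (firstPrimes j)
firstPrimes-unique zero    = []
firstPrimes-unique (suc j) =
  All.map (λ q≤ eq → <⇒≢ (≤-<-trans q≤ (p-< j)) (sym eq)) (firstPrimes-≤ j)
  ∷ firstPrimes-unique j

firstPrimes-length : ∀ j → length (firstPrimes j) ≡ j
firstPrimes-length zero    = refl
firstPrimes-length (suc j) = cong suc (firstPrimes-length j)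

firstPrimes-sum : ∀ j → sum (firstPrimes j) ≡ σ j
firstPrimes-sum zero    = refl
firstPrimes-sum (suc j) = trans (cong (p (suc j) +_) (firstPrimes-sum j)) (+-comm (p (suc j)) (σ j))

admissible-exists : ∀ n → ∃ (Admissible n)
admissible-exists n with product-admissible [] []
... | admissible sf _ ℓ≤0 = 1 , admissible sf (≤-trans ℓ≤0 z≤n)

admissible[_]-exists : ∀ j n → σ j ≤ n → ∃ (Admissible[ j ] n)
admissible[ j ]-exists n σj≤n
  with product-admissible (firstPrimes-prime j) (firstPrimes-unique j)
... | admissible sf ω≡ ℓ≤ = product (firstPrimes j) ,
  admissible sf (trans ω≡ (firstPrimes-length j))
                (≤-trans ℓ≤ (≤-trans (≤-reflexive (firstPrimes-sum j)) σj≤n))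

maximum : ∀ n → ∃ (IsGreatest (Admissible n))
maximum n = greatest (admissible? n) (admissible-exists n) (2 ^ n) (admissible-bound n)

maximum[_] : ∀ j n → σ j ≤ n → ∃ (IsGreatest (Admissible[ j ] n))
maximum[ j ] n σj≤n =
  greatest (admissible[ j ]? n) (admissible[ j ]-exists n σj≤n) (2 ^ n) (admissible[ j ]-bound n)

h : ℕ → ℕ
h n = proj₁ (maximum n)

-- h_j(n) is defined only for n ≥ σ_j, whence the extra argument.
h[_] : ∀ j n → σ j ≤ n → ℕ
h[ j ] n σj≤n = proj₁ (maximum[ j ] n σj≤n)

{-# OPTIONS --safe #-}
-- A set of j < k primes with sum at most n is exchanged for a set of j + 1 primes with sum at
-- most n and no smaller product.  Compare it with the first j + 1 primes, whose sum is at most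
-- σ k ≤ n: let A be the primes occurring only among the latter, B those occurring only in the
-- given set, and c = min A, so that |A| = |B| + 1.  If some b in B and a ≠ c in A satisfy
-- a + c ≤ b, then some prime q of the set and some missing prime x also satisfy q ≤ c x
-- (by Bertrand's postulate), and q can be replaced by c and x.  Otherwise B is close to A, and
-- one adjoins c and trades elements of B for elements of A ∖ {c} until the sum has
-- decreased by c; the product then has shrunk by a factor of at most c.
-- Bertrand's postulate cannot be avoided: applied to n = σ (i + 1) - 2 - p i, for the set of the
-- first i + 1 primes without 2 and p i, the theorem yields p (i + 1) ≤ 2 p i.
module Submission where

open import Defs
open import Data.Empty using (⊥; ⊥-elim)
open import Data.Nat
open import Data.Nat.Properties
open import Data.Nat.Combinatorics using ([n∸k]!k!∣n!)
open import Data.Nat.Coprimality using (Coprime; coprime-divisor)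
open import Data.Nat.Divisibility
open import Data.Nat.DivMod using (/-monoˡ-≤; m*n/n≡m; m/n*n≤m)
open import Data.Nat.Induction using (<-wellFounded)
open import Data.Nat.ListAction using (sum; product)
open import Data.Nat.ListAction.Properties using (∈⇒∣product; sum-++; sum-↭; product-++; product-↭)
open import Data.Nat.Primality
open import Data.Nat.Primality.Factorisation using (PrimeFactorisation; factorise; factorisationHasAllPrimeFactors)
open import Data.Nat.Tactic.RingSolver using (solve-∀)
open import Data.List using (List; []; _∷_; _++_; length; filter; downFrom)
open import Data.List.Properties using (filter-reject; length-++)
open import Data.List.Membership.Propositional using (_∈_; _∉_; find; lose)
open import Data.List.Membership.DecPropositional _≟_ using (_∈?_)
open import Data.List.Membership.Propositional.Properties using (∈-filter⁺; ∈-filter⁻; ∈-downFrom⁺; ∈-downFrom⁻; ∈-∃++; ∈-++⁺ˡ; ∈-++⁺ʳ; ∈-++⁻)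
open import Data.List.Relation.Binary.Permutation.Propositional using (_↭_; ↭-refl; ↭-sym; ↭-trans; prep; swap; ↭⇒↭ₛ)
open import Data.List.Relation.Binary.Permutation.Propositional.Properties using (All-resp-↭; ∈-resp-↭; ↭-length; shift; ++-comm; ++⁺ˡ; ++⁺ʳ; ++-assoc; ++-identityʳ)
open import Data.List.Relation.Binary.Permutation.Setoid.Properties as SetoidPermutation using ()
open import Data.List.Relation.Unary.All as All using (All; []; _∷_)
open import Data.List.Relation.Unary.All.Properties as All using (all-filter)
open import Data.List.Relation.Unary.AllPairs using ([]; _∷_)
open import Data.List.Relation.Unary.Any using (here; there; any?)
open import Data.List.Relation.Unary.Unique.Propositional using (Unique)
open import Data.List.Relation.Unary.Unique.Propositional.Properties as Unique using ()
open import Data.Product using (∃; ∃₂; _×_; _,_; proj₁; proj₂)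
open import Data.Sum using (_⊎_; inj₁; inj₂; [_,_]′)
open import Function using (_∘_)
open import Induction.WellFounded using (Acc; acc)
open import Relation.Binary.PropositionalEquality using (_≡_; _≢_; refl; sym; trans; cong; subst; subst₂; setoid)
open import Relation.Nullary using (¬_; yes; no; contradiction)
open import Relation.Nullary.Decidable using (from-yes)

-- Bertrand's postulate

prime>1 : ∀ {q} → Prime q → 1 < q
prime>1 q-prime = nonTrivial⇒n>1 _ {{prime⇒nonTrivial q-prime}}

prime>0 : ∀ {q} → Prime q → 0 < q
prime>0 = <⇒≤ ∘ prime>1

prime∤1 : ∀ {q} → Prime q → ¬ q ∣ 1
prime∤1 q-prime q∣1 = ¬prime[1] (subst Prime (∣1⇒≡1 q∣1) q-prime)

∤⇒coprime : ∀ {q i} → Prime q → ¬ q ∣ i → Coprime i q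
∤⇒coprime q-prime q∤i (d∣i , d∣q) with prime⇒irreducible q-prime d∣q
... | inj₁ d≡1  = d≡1
... | inj₂ refl = contradiction d∣i q∤i

prime^-cancelˡ : ∀ {q} → Prime q → ∀ e {a b} → ¬ q ∣ a → q ^ e ∣ a * b → q ^ e ∣ b
prime^-cancelˡ q-prime zero {b = b} q∤a _ = 1∣ b
prime^-cancelˡ {q} q-prime (suc e) {a} {b} q∤a qᵉ∣ab
  with euclidsLemma a b q-prime (∣-trans (m∣m*n (q ^ e)) qᵉ∣ab)
... | inj₁ q∣a = contradiction q∣a q∤a
... | inj₂ (divides b′ refl) = subst (q * q ^ e ∣_) (*-comm q b′)
  (*-monoʳ-∣ q (prime^-cancelˡ q-prime e q∤a (*-cancelˡ-∣ q {{prime⇒nonZero q-prime}}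
    (subst (q * q ^ e ∣_) (rearrange a b′ q) qᵉ∣ab))))
  where
  rearrange : ∀ x y z → x * (y * z) ≡ z * (x * y)
  rearrange = solve-∀

cancel-prime^ : ∀ {q} → Prime q → ∀ e {i u} → ¬ q ∣ i → i ∣ q ^ e * u → i ∣ u
cancel-prime^ q-prime zero {i} {u} q∤i i∣ = subst (i ∣_) (*-identityˡ u) i∣
cancel-prime^ {q} q-prime (suc e) {i} {u} q∤i i∣ =
  cancel-prime^ q-prime e q∤i
    (coprime-divisor (∤⇒coprime q-prime q∤i) (subst (i ∣_) (*-assoc q (q ^ e) u) i∣))

-- The exponent `e` is the `q`-adic valuation of `N`, obtained by dividing by `q` as long as
-- possible.
prime-part : ∀ {q} → Prime q → ∀ N → .{{NonZero N}} → ∃₂ λ e u → N ≡ q ^ e * u × ¬ q ∣ u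
prime-part {q} q-prime N = go N (<-wellFounded N)
  where
  go : ∀ N → .{{NonZero N}} → Acc _<_ N → ∃₂ λ e u → N ≡ q ^ e * u × ¬ q ∣ u
  go N (acc rec) with q ∣? N
  ... | no q∤N = 0 , N , sym (*-identityˡ N) , q∤N
  ... | yes q∣N with go (quotient q∣N) {{quotient≢0 q∣N}}
                        (rec (quotient-< q∣N {{prime⇒nonTrivial q-prime}}))
  ...   | e , u , eq , q∤u = suc e , u ,
    trans (m∣n⇒n≡m*quotient q∣N) (trans (cong (q *_) eq) (sym (*-assoc q (q ^ e) u))) , q∤u

-- By induction `N` is `M * product qs`. A prime dividing `product qs` is one of the `qs`, so the
-- new prime `q` must divide `M`.
unique-primes∣ : ∀ {qs N} → All Prime qs → Unique qs → All (_∣ N) qs → product qs ∣ N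
unique-primes∣ [] [] [] = 1∣ _
unique-primes∣ {q ∷ qs} {N} (q-prime ∷ qs-prime) (q∉qs ∷ qs-unique) (q∣N ∷ qs∣N)
  with unique-primes∣ qs-prime qs-unique qs∣N
... | divides M refl with euclidsLemma M (product qs) q-prime q∣N
...   | inj₁ q∣M = *-monoˡ-∣ (product qs) q∣M
...   | inj₂ q∣Π = contradiction refl (All.lookup q∉qs
  (factorisationHasAllPrimeFactors q-prime q∣Π qs-prime))

-- A multiple of q below q * suc j is q * i with i ≤ j < q, so it carries only one factor q.
prime^∤! : ∀ {q} → Prime q → ∀ m j → j < q → m < q * suc j → ¬ q ^ suc j ∣ m !
prime^∤! {q} q-prime zero j _ _ qʲ∣1 = prime∤1 q-prime (∣-trans (m∣m*n (q ^ j)) qʲ∣1)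
prime^∤! {q} q-prime (suc m) j j<q m<qj qʲ∣ with q ∣? suc m
... | no q∤sm = prime^∤! q-prime m j j<q (<-trans (n<1+n m) m<qj)
                  (prime^-cancelˡ q-prime (suc j) q∤sm qʲ∣)
... | yes (divides i sm≡iq) = go j j<q i≤j qʲ∣
  where
  instance
    q-nonZero : NonZero q
    q-nonZero = prime⇒nonZero q-prime
  i≤j : i ≤ j
  i≤j = ≤-pred (*-cancelˡ-< q i (suc j)
    (subst (_< q * suc j) (trans sm≡iq (*-comm i q)) m<qj))
  0<i : 0 < i
  0<i = n≢0⇒n>0 λ { refl → 1+n≢0 sm≡iq }
  go : ∀ j → j < q → i ≤ j → ¬ q ^ suc j ∣ suc m * m !
  go zero _ i≤0 _ = contradiction 0<i (≤⇒≯ i≤0)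
  go (suc j) j<q i≤j qʲ∣ = prime^∤! q-prime m j (<-trans (n<1+n j) j<q) m<
    (prime^-cancelˡ q-prime (suc j) q∤i (*-cancelˡ-∣ q (subst (q * q ^ suc j ∣_) eq qʲ∣)))
    where
    m< : m < q * suc j
    m< = ≤-trans (≤-reflexive (trans sm≡iq (*-comm i q))) (*-monoʳ-≤ q i≤j)
    q∤i : ¬ q ∣ i
    q∤i q∣i = contradiction (≤-trans j<q (∣⇒≤ {{>-nonZero 0<i}} q∣i)) (≤⇒≯ i≤j)
    eq : suc m * m ! ≡ q * (i * m !)
    eq = trans (cong (_* m !) (trans sm≡iq (*-comm i q))) (*-assoc q i (m !))

-- Prime powers in central binomial coefficients

m!*n!∣[m+n]! : ∀ m n → m ! * n ! ∣ (m + n) !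
m!*n!∣[m+n]! m n = subst (λ o → o ! * n ! ∣ (m + n) !) (m+n∸n≡m m n) ([n∸k]!k!∣n! (m≤n+m n m))

-- Leibniz' harmonic triangle: a! b! / (a+b+1)! = 1 / ((a+b+1) C(a+b,a)) satisfies
-- the subtractive Pascal rule, whose first row 1 / (b+1) becomes integral after multiplying by L.
leibniz : ∀ {L m} → (∀ {i} → 0 < i → i ≤ m → i ∣ L) →
          ∀ a b → suc (a + b) ≤ m → suc (a + b) ! ∣ L * (a ! * b !)
leibniz {L} common zero b b<m =
  *-pres-∣ (common (s≤s z≤n) b<m) (subst (b ! ∣_) (sym (*-identityˡ (b !))) ∣-refl)
leibniz {L} {m} common (suc a) b ab<m = ∣m+n∣m⇒∣n
  (subst (suc (suc (a + b)) ! ∣_) (pascal L a b (a !) (b !))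
    (*-monoʳ-∣ (suc (suc (a + b))) (leibniz common a b (<⇒≤ ab<m))))
  (subst (λ s → suc s ! ∣ L * (a ! * suc b !)) (+-suc a b)
    (leibniz common a (suc b) (subst (_< m) (sym (+-suc a b)) ab<m)))
  where
  pascal : ∀ L a b x y → suc (suc (a + b)) * (L * (x * y)) ≡
           L * (x * (suc b * y)) + L * (suc a * x * y)
  pascal = solve-∀

-- Here `N` is the central binomial coefficient. Suppose that `q ^ suc e` divides `N` but exceeds
-- `n + n`, and write `(n + n) !` as `q ^ v * u` with `q` prime to `u`. Then `L = q ^ e * u` is a
-- common multiple of `1`, ..., `n + n`: the power of `q` in such a number has exponent at most `e`,
-- and the cofactor divides `u`. By `leibniz`, `N` divides `L`, so `q ^ suc e` divides `q ^ e * u`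
-- and `q` divides `u`.
central-prime^≤ : ∀ {n N q} e → 0 < n → (n + n) ! ≡ N * (n ! * n !) →
                  Prime q → q ^ e ∣ N → q ^ e ≤ n + n
central-prime^≤ {suc a} {N} {q} zero    0<n eq q-prime qᵉ∣N = s≤s z≤n
central-prime^≤ {n@(suc a)} {N} {q} (suc e) 0<n eq q-prime qᵉ∣N = ≮⇒≥ impossible
  where
  instance
    q-nonZero : NonZero q
    q-nonZero = prime⇒nonZero q-prime
    n!n!-nonZero : NonZero (n ! * n !)
    n!n!-nonZero = m*n≢0 (n !) (n !) {{n !≢0}} {{n !≢0}}
  impossible : ¬ n + n < q ^ suc e
  impossible 2n<qᵉ with prime-part q-prime ((n + n) !) {{(n + n) !≢0}}
  ... | v , u , 2n!≡ , q∤u = q∤u (*-cancelˡ-∣ (q ^ e) {{m^n≢0 q e}}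
          (subst (_∣ q ^ e * u) (*-comm q (q ^ e)) (∣-trans qᵉ∣N N∣L)))
    where
    L = q ^ e * u
    common : ∀ {i} → 0 < i → i ≤ n + n → i ∣ L
    common {i} 0<i i≤2n with prime-part q-prime i {{>-nonZero 0<i}}
    ... | f , i′ , refl , q∤i′ = *-pres-∣ qᶠ∣qᵉ i′∣u
      where
      instance
        i-nonZero : NonZero (q ^ f * i′)
        i-nonZero = >-nonZero 0<i
        i′-nonZero : NonZero i′
        i′-nonZero = m*n≢0⇒n≢0 (q ^ f)
      f≤e : f ≤ e
      f≤e = ≮⇒≥ λ e<f → <⇒≱ 2n<qᵉ
        (≤-trans (^-monoʳ-≤ q e<f) (≤-trans (m≤m*n (q ^ f) i′) i≤2n))
      qᶠ∣qᵉ : q ^ f ∣ q ^ e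
      qᶠ∣qᵉ with m≤n⇒∃[o]m+o≡n f≤e
      ... | g , refl = subst (q ^ f ∣_) (sym (^-distribˡ-+-* q f g)) (m∣m*n (q ^ g))
      i′∣u : i′ ∣ u
      i′∣u = cancel-prime^ q-prime v q∤i′
        (subst (i′ ∣_) 2n!≡ (∣-trans (n∣m*n (q ^ f)) (∣! i≤2n)))
    -- With `n = suc a`, the entry `(n , a)` of the triangle has denominator `(n + n) !`; the
    -- missing factor `n` turns `a !` into `n !`.
    N∣L : N ∣ L
    N∣L = *-cancelʳ-∣ (n ! * n !) (∣-trans
      (subst (_∣ L * (n ! * a !))
             (trans (cong _! (cong suc (sym (+-suc a a)))) eq)
             (leibniz common n a (≤-reflexive (cong suc (sym (+-suc a a))))))
      (*-monoʳ-∣ L (*-monoʳ-∣ (n !) (n∣m*n n))))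

even⊎odd : ∀ n → ∃ λ m → n ≡ m + m ⊎ n ≡ suc (m + m)
even⊎odd zero = 0 , inj₁ refl
even⊎odd (suc n) with even⊎odd n
... | m , inj₁ eq = m , inj₂ (cong suc eq)
... | m , inj₂ eq = suc m , inj₁ (trans (cong suc eq) (cong suc (sym (+-suc m m))))

¬prime-double : ∀ {m} → 1 < m → ¬ Prime (m + m)
¬prime-double {m} 1<m 2m-prime =
  <⇒≢ (m<m+n m (<⇒≤ 1<m)) (prime∣double≡ (∣m∣n⇒∣m+n ∣-refl ∣-refl))
  where
  prime∣double≡ : m ∣ m + m → m ≡ m + m
  prime∣double≡ m∣2m with prime⇒irreducible 2m-prime m∣2m
  ... | inj₁ m≡1  = contradiction (sym m≡1) (<⇒≢ 1<m)
  ... | inj₂ m≡2m = m≡2m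

-- Primorials and bounds for binomial coefficients

primes≤ : ℕ → List ℕ
primes≤ x = filter prime? (downFrom (suc x))

primorial : ℕ → ℕ
primorial x = product (primes≤ x)

primes≤-prime : ∀ x → All Prime (primes≤ x)
primes≤-prime x = all-filter prime? (downFrom (suc x))

primes≤-unique : ∀ x → Unique (primes≤ x)
primes≤-unique x = Unique.filter⁺ prime? (Unique.downFrom⁺ (suc x))

∈-primes≤⁺ : ∀ {x q} → Prime q → q ≤ x → q ∈ primes≤ x
∈-primes≤⁺ q-prime q≤x = ∈-filter⁺ prime? (∈-downFrom⁺ (s≤s q≤x)) q-prime

∈-primes≤⁻ : ∀ {x q} → q ∈ primes≤ x → q ≤ x × Prime q
∈-primes≤⁻ {x} q∈ with ∈-filter⁻ prime? {xs = downFrom (suc x)} q∈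
... | q∈down , q-prime = ≤-pred (∈-downFrom⁻ q∈down) , q-prime

primorial-¬prime : ∀ {x} → ¬ Prime (suc x) → primorial (suc x) ≡ primorial x
primorial-¬prime ¬sx-prime = cong product (filter-reject prime? ¬sx-prime)

primorial>0 : ∀ x → 0 < primorial x
primorial>0 x = productOfPrimes≥1 (primes≤-prime x)

-- This is C(2m+1, m) ≤ 4^m without division. The step multiplies the coefficient by (2m+3)(2m+2) /
-- ((m+2)(m+1)), which is at most 4 because 2m+3 ≤ 2m+4.
[2m+1]!≤ : ∀ m → suc (m + m) ! ≤ 4 ^ m * (suc m ! * m !)
[2m+1]!≤ zero = ≤-refl
[2m+1]!≤ (suc m) = begin
  suc (suc m + suc m) !
    ≡⟨ cong (λ s → suc (suc s) !) (+-suc m m) ⟩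
  suc (suc (suc (m + m))) * (suc (suc (m + m)) * suc (m + m) !)
    ≤⟨ *-monoʳ-≤ (3 + (m + m)) (*-monoʳ-≤ (2 + (m + m)) ([2m+1]!≤ m)) ⟩
  (3 + (m + m)) * ((2 + (m + m)) * (4 ^ m * (suc m ! * m !)))
    ≤⟨ *-monoˡ-≤ ((2 + (m + m)) * (4 ^ m * (suc m ! * m !))) (n≤1+n (3 + (m + m))) ⟩
  (4 + (m + m)) * ((2 + (m + m)) * (4 ^ m * (suc m ! * m !)))
    ≡⟨ rearrange m (4 ^ m) (suc m !) (m !) ⟩
  4 ^ suc m * (suc (suc m) ! * suc m !) ∎
  where
  open ≤-Reasoning
  rearrange : ∀ m x y z → (4 + (m + m)) * ((2 + (m + m)) * (x * (y * z))) ≡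
                          4 * x * ((2 + m) * y * ((1 + m) * z))
  rearrange = solve-∀

-- This is 4^n ≤ 2n C(2n, n) for n ≥ 1. The step from n to n+1 multiplies the left side by (2n+2)²
-- and uses 2n ≤ 2n+1 on the right.
4^n*n!n!≤ : ∀ n → 4 ^ suc n * (suc n ! * suc n !) ≤ (suc n + suc n) * (suc n + suc n) !
4^n*n!n!≤ zero = ≤-refl
4^n*n!n!≤ (suc n′) = begin
  4 ^ suc n * (suc n ! * suc n !)
    ≡⟨ rearrange n (4 ^ n) (n !) ⟩
  4 * (1 + n) * (1 + n) * (4 ^ n * (n ! * n !))
    ≤⟨ *-monoʳ-≤ (4 * (1 + n) * (1 + n)) (4^n*n!n!≤ n′) ⟩
  4 * (1 + n) * (1 + n) * ((n + n) * (n + n) !)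
    ≤⟨ *-monoʳ-≤ (4 * (1 + n) * (1 + n)) (*-monoˡ-≤ ((n + n) !) (n≤1+n (n + n))) ⟩
  4 * (1 + n) * (1 + n) * ((1 + (n + n)) * (n + n) !)
    ≡⟨ rearrange′ n ((n + n) !) ⟩
  (2 + (n + n)) * ((2 + (n + n)) * ((1 + (n + n)) * (n + n) !))
    ≡⟨ cong (λ s → suc s * suc s !) (+-suc n n) ⟨
  (suc n + suc n) * (suc n + suc n) ! ∎
  where
  open ≤-Reasoning
  n = suc n′
  rearrange : ∀ n x y → 4 * x * ((1 + n) * y * ((1 + n) * y)) ≡
                        4 * (1 + n) * (1 + n) * (x * (y * y))
  rearrange = solve-∀
  rearrange′ : ∀ n x → 4 * (1 + n) * (1 + n) * ((1 + (n + n)) * x) ≡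
                       (2 + (n + n)) * ((2 + (n + n)) * ((1 + (n + n)) * x))
  rearrange′ = solve-∀

prime∣!⇒≤ : ∀ {q} m → Prime q → q ∣ m ! → q ≤ m
prime∣!⇒≤ zero q-prime q∣1 = contradiction q∣1 (prime∤1 q-prime)
prime∣!⇒≤ (suc m) q-prime q∣ with euclidsLemma (suc m) (m !) q-prime q∣
... | inj₁ q∣sm = ∣⇒≤ q∣sm
... | inj₂ q∣m! = m≤n⇒m≤1+n (prime∣!⇒≤ m q-prime q∣m!)

-- A prime above `suc m` and up to `suc (m + m)` divides the numerator of the binomial coefficient
-- `C` but not its denominator, hence divides `C`. The smaller primes divide `primorial (suc m)`.
primorial-odd : ∀ m → primorial (suc (m + m)) ≤ 4 ^ m * primorial (suc m)
primorial-odd m with m!*n!∣[m+n]! (suc m) m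
... | divides C eq = ≤-trans
  (∣⇒≤ {{m*n≢0 C (primorial (suc m)) {{C≢0}} {{>-nonZero (primorial>0 (suc m))}}}}
    (unique-primes∣ (primes≤-prime (suc (m + m))) (primes≤-unique (suc (m + m))) (All.tabulate divides-each)))
  (*-monoˡ-≤ (primorial (suc m)) C≤4^m)
  where
  instance
    d-nonZero : NonZero (suc m ! * m !)
    d-nonZero = m*n≢0 _ _ {{suc m !≢0}} {{m !≢0}}
  C≤4^m : C ≤ 4 ^ m
  C≤4^m = *-cancelʳ-≤ C (4 ^ m) (suc m ! * m !)
    (subst (_≤ 4 ^ m * (suc m ! * m !)) eq ([2m+1]!≤ m))
  C≢0 : NonZero C
  C≢0 = ≢-nonZero λ { refl → <⇒≢ (1≤n! (suc (m + m))) (sym eq) }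
  divides-each : ∀ {q} → q ∈ primes≤ (suc (m + m)) → q ∣ C * primorial (suc m)
  divides-each {q} q∈ with ∈-primes≤⁻ {suc (m + m)} q∈
  ... | q≤ , q-prime with q ≤? suc m
  ...   | yes q≤sm = ∣n⇒∣m*n C (∈⇒∣product (∈-primes≤⁺ q-prime q≤sm))
  ...   | no q≰sm with euclidsLemma C (suc m ! * m !) q-prime
                        (subst (q ∣_) eq (∣! {{prime⇒nonZero q-prime}} q≤))
  ...     | inj₁ q∣C = ∣m⇒∣m*n (primorial (suc m)) q∣C
  ...     | inj₂ q∣d with euclidsLemma (suc m !) (m !) q-prime q∣d
  ...       | inj₁ q∣ = contradiction (prime∣!⇒≤ (suc m) q-prime q∣) q≰sm
  ...       | inj₂ q∣ = contradiction (m≤n⇒m≤1+n (prime∣!⇒≤ m q-prime q∣)) q≰sm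

-- An even number above 2 adds no prime, which leads back to its predecessor. For odd arguments
-- `primorial-odd` leads back to `suc m`, and the exponents `m` and `suc m` add up to `suc (m + m)`.
primorial≤4^ : ∀ x → primorial x ≤ 4 ^ x
primorial≤4^ x = go x (<-wellFounded x)
  where
  open ≤-Reasoning
  go : ∀ x → Acc _<_ x → primorial x ≤ 4 ^ x
  go x (acc rec) with even⊎odd x
  ... | zero , inj₁ refl = s≤s z≤n
  ... | suc zero , inj₁ refl = from-yes (primorial 2 ≤? 16)
  ... | m@(suc (suc k)) , inj₁ refl = begin
    primorial (m + m) ≡⟨ primorial-¬prime (¬prime-double {m} (s≤s (s≤s z≤n))) ⟩
    primorial (pred (m + m)) ≤⟨ go (pred (m + m)) (rec ≤-refl) ⟩
    4 ^ pred (m + m) ≤⟨ ^-monoʳ-≤ 4 (n≤1+n (pred (m + m))) ⟩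
    4 ^ (m + m) ∎
  ... | zero , inj₂ refl = s≤s z≤n
  ... | m@(suc _) , inj₂ refl = begin
    primorial (suc (m + m))     ≤⟨ primorial-odd m ⟩
    4 ^ m * primorial (suc m)   ≤⟨ *-monoʳ-≤ (4 ^ m) (go (suc m) (rec (s≤s (m<m+n m (s≤s z≤n))))) ⟩
    4 ^ m * 4 ^ suc m           ≡⟨ ^-distribˡ-+-* 4 m (suc m) ⟨
    4 ^ (m + suc m)             ≡⟨ cong (4 ^_) (+-suc m m) ⟩
    4 ^ suc (m + m)             ∎

-- Bounding a number through its prime powers

module _ {B : ℕ} (B>0 : 0 < B) where

  -- Every number from 1 to `x`, prime or not, is allotted one factor `B`, which covers the full
  -- power of that prime in `N`.
  smooth-bound : ∀ x N → 0 < N → (∀ {q} → Prime q → q ∣ N → q ≤ x) →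
                 (∀ {q} e → Prime q → q ^ e ∣ N → q ^ e ≤ B) → N ≤ B ^ x
  smooth-bound zero N N>0 q≤x q^≤B = ≮⇒≥ λ 1<N → no-divisor (primeDivisor N 1<N)
    where
    no-divisor : ¬ ∃ λ q → Prime q × q ∣ N
    no-divisor (q , q-prime , q∣N) = <⇒≱ (prime>0 q-prime) (q≤x q-prime q∣N)
  smooth-bound (suc x) N N>0 q≤x q^≤B with prime? (suc x)
  ... | no ¬sx-prime = ≤-trans
    (smooth-bound x N N>0 (λ q-prime q∣N → ≤-pred (≤∧≢⇒< (q≤x q-prime q∣N) λ { refl → ¬sx-prime q-prime })) q^≤B)
    (^-monoʳ-≤ B {{>-nonZero B>0}} (n≤1+n x))
  ... | yes sx-prime with prime-part sx-prime N {{>-nonZero N>0}}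
  ...   | e , u , refl , ∤u = *-mono-≤ (q^≤B e sx-prime (m∣m*n u))
    (smooth-bound x u (>-nonZero⁻¹ u {{m*n≢0⇒n≢0 (suc x ^ e) {{>-nonZero N>0}}}})
      (λ q-prime q∣u → ≤-pred (≤∧≢⇒< (q≤x q-prime (∣n⇒∣m*n (suc x ^ e) q∣u)) λ { refl → ∤u q∣u }))
      (λ f q-prime q^∣u → q^≤B f q-prime (∣n⇒∣m*n (suc x ^ e) q^∣u)))

  -- Primes are split off from the top. One above `s` occurs at most once and is paid for by the
  -- primorial; as soon as the remaining primes are at most `s`, `smooth-bound` covers them all by
  -- `B ^ s`.
  almost-squarefree-bound : ∀ s x N → 0 < N → (∀ {q} → Prime q → q ∣ N → q ≤ x) →
    (∀ {q} e → Prime q → q ^ e ∣ N → q ^ e ≤ B) →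
    (∀ {q} → Prime q → s < q → ¬ q * q ∣ N) → N ≤ B ^ s * primorial x
  almost-squarefree-bound s zero N N>0 q≤x q^≤B q²∤ = ≤-trans
    (smooth-bound zero N N>0 q≤x q^≤B)
    (*-mono-≤ (m^n>0 B {{>-nonZero B>0}} s) (primorial>0 zero))
  almost-squarefree-bound s (suc x) N N>0 q≤x q^≤B q²∤ with suc x ≤? s
  ... | yes x<s = begin
    N                          ≤⟨ smooth-bound (suc x) N N>0 q≤x q^≤B ⟩
    B ^ suc x                  ≤⟨ ^-monoʳ-≤ B {{>-nonZero B>0}} x<s ⟩
    B ^ s                      ≤⟨ m≤m*n (B ^ s) (primorial (suc x)) {{>-nonZero (primorial>0 (suc x))}} ⟩
    B ^ s * primorial (suc x)  ∎
    where open ≤-Reasoning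
  ... | no x≮s with prime? (suc x)
  ...   | no ¬sx-prime =
    almost-squarefree-bound s x N N>0
      (λ q-prime q∣N → ≤-pred (≤∧≢⇒< (q≤x q-prime q∣N) λ { refl → ¬sx-prime q-prime })) q^≤B q²∤
  ...   | yes sx-prime with prime-part sx-prime N {{>-nonZero N>0}}
  ...     | e , u , refl , ∤u = begin
    suc x ^ e * u                      ≤⟨ *-mono-≤ (single e (λ q² → q²∤ sx-prime (≰⇒> x≮s) (∣m⇒∣m*n u q²))) rec ⟩
    suc x * (B ^ s * primorial x)      ≡⟨ rearrange (suc x) (B ^ s) (primorial x) ⟩
    B ^ s * (suc x * primorial x)      ∎
    where
    open ≤-Reasoning
    rearrange : ∀ a b c → a * (b * c) ≡ b * (a * c)
    rearrange = solve-∀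
    single : ∀ e → ¬ suc x * suc x ∣ suc x ^ e → suc x ^ e ≤ suc x
    single zero          _   = s≤s z≤n
    single (suc zero)    _   = ≤-reflexive (*-identityʳ (suc x))
    single (suc (suc e)) sq∤ = contradiction
      (subst (suc x * suc x ∣_) (*-assoc (suc x) (suc x) (suc x ^ e)) (m∣m*n (suc x ^ e))) sq∤
    rec = almost-squarefree-bound s x u (>-nonZero⁻¹ u {{m*n≢0⇒n≢0 (suc x ^ e) {{>-nonZero N>0}}}})
      (λ q-prime q∣u → ≤-pred (≤∧≢⇒< (q≤x q-prime (∣n⇒∣m*n (suc x ^ e) q∣u)) λ { refl → ∤u q∣u }))
      (λ f q-prime q^∣u → q^≤B f q-prime (∣n⇒∣m*n (suc x ^ e) q^∣u))
      (λ q-prime s<q q²∣u → q²∤ q-prime s<q (∣n⇒∣m*n (suc x ^ e) q²∣u))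

-- Numerical estimates

integer-sqrt : ∀ m → ∃ λ s → s * s ≤ m × m < suc s * suc s
integer-sqrt zero = 0 , z≤n , s≤s z≤n
integer-sqrt (suc m) with integer-sqrt m
... | s , s²≤m , m<[s+1]² with suc m <? suc s * suc s
...   | yes m+1< = s , m≤n⇒m≤1+n s²≤m , m+1<
...   | no  m+1≮ = suc s , ≮⇒≥ m+1≮ ,
  ≤-<-trans m<[s+1]² (*-mono-< (n<1+n (suc s)) (n<1+n (suc s)))

*-^-distrib : ∀ m n o → (m * n) ^ o ≡ m ^ o * n ^ o
*-^-distrib m n zero = refl
*-^-distrib m n (suc o) = trans (cong (m * n *_) (*-^-distrib m n o)) (rearrange m n (m ^ o) (n ^ o))
  where
  rearrange : ∀ a b c d → a * b * (c * d) ≡ a * c * (b * d)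
  rearrange = solve-∀

^-ratio : ∀ {c d k} o .{{_ : NonZero (c ^ o)}} → d ^ o ≤ c ^ o * k →
          ∀ {x y} → c * y ≤ d * x → y ^ o ≤ k * x ^ o
^-ratio {c} {d} {k} o dᵒ≤ {x} {y} cy≤dx = *-cancelˡ-≤ (c ^ o) (begin
  c ^ o * y ^ o        ≡⟨ *-^-distrib c y o ⟨
  (c * y) ^ o          ≤⟨ ^-monoˡ-≤ o cy≤dx ⟩
  (d * x) ^ o          ≡⟨ *-^-distrib d x o ⟩
  d ^ o * x ^ o        ≤⟨ *-monoˡ-≤ (x ^ o) dᵒ≤ ⟩
  c ^ o * k * x ^ o    ≡⟨ *-assoc (c ^ o) k (x ^ o) ⟩
  c ^ o * (k * x ^ o)  ∎)
  where open ≤-Reasoning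

-- Equality holds at `k = 0`. Each step multiplies the base by at most 11/10, and (11/10)^6 < 2.
sixth-power≤ : ∀ k → (k + 32) ^ 6 ≤ 2 ^ (k + 30)
sixth-power≤ zero = from-yes (32 ^ 6 ≤? 2 ^ 30)
sixth-power≤ (suc k) = ≤-trans
  (^-ratio {10} {11} {2} 6 (from-yes (11 ^ 6 ≤? 10 ^ 6 * 2)) {k + 32} {suc k + 32}
    (≤-trans (m≤m+n (10 * (suc k + 32)) (22 + k)) (≤-reflexive (slack k))))
  (*-monoʳ-≤ 2 (sixth-power≤ k))
  where
  slack : ∀ k → 10 * (suc k + 32) + (22 + k) ≡ 11 * (k + 32)
  slack = solve-∀

-- Cubing removes the fraction from the bound `x` ≤ 2n/3; what remains of 4^(3n) after division by
-- 4^(2n) is 4^n.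
^-cube-≤ : ∀ n {x y} → 4 ^ n ≤ y * 4 ^ x → x * 3 ≤ n + n → 4 ^ n ≤ y ^ 3
^-cube-≤ n {x} {y} 4ⁿ≤ 3x≤2n = *-cancelʳ-≤ (4 ^ n) (y ^ 3) (4 ^ (n + n)) {{m^n≢0 4 (n + n)}} (begin
  4 ^ n * 4 ^ (n + n)      ≡⟨ cong (4 ^ n *_) (^-distribˡ-+-* 4 n n) ⟩
  4 ^ n * (4 ^ n * 4 ^ n)  ≡⟨ cube (4 ^ n) ⟩
  (4 ^ n) ^ 3              ≤⟨ ^-monoˡ-≤ 3 4ⁿ≤ ⟩
  (y * 4 ^ x) ^ 3          ≡⟨ *-^-distrib y (4 ^ x) 3 ⟩
  y ^ 3 * (4 ^ x) ^ 3      ≡⟨ cong (y ^ 3 *_) (^-*-assoc 4 x 3) ⟩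
  y ^ 3 * 4 ^ (x * 3)      ≤⟨ *-monoʳ-≤ (y ^ 3) (^-monoʳ-≤ 4 3x≤2n) ⟩
  y ^ 3 * 4 ^ (n + n)      ∎)
  where
  open ≤-Reasoning
  cube : ∀ y → y * (y * y) ≡ y * (y * (y * 1))
  cube = solve-∀

-- Meant for `m` = 2n, `u` = s+1 and `t` = s-1, where s is the integer square root of 2n: then
-- `t * u` = s²-1 < 2n.
[m^u]³<4^ : ∀ {n m u t} → m ≤ u * u → u ^ 6 ≤ 2 ^ t → t * u < n + n → (m ^ u) ^ 3 < 4 ^ n
[m^u]³<4^ {n} {m} {u} {t} m≤u² u⁶≤2ᵗ tu<2n = begin-strict
  (m ^ u) ^ 3        ≤⟨ ^-monoˡ-≤ 3 (^-monoˡ-≤ u m≤u²) ⟩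
  ((u * u) ^ u) ^ 3  ≡⟨ ^-*-assoc (u * u) u 3 ⟩
  (u * u) ^ (u * 3)  ≡⟨ cong ((u * u) ^_) (*-comm u 3) ⟩
  (u * u) ^ (3 * u)  ≡⟨ ^-*-assoc (u * u) 3 u ⟨
  ((u * u) ^ 3) ^ u  ≡⟨ cong (_^ u) (sixth u) ⟩
  (u ^ 6) ^ u        ≤⟨ ^-monoˡ-≤ u u⁶≤2ᵗ ⟩
  (2 ^ t) ^ u        ≡⟨ ^-*-assoc 2 t u ⟩
  2 ^ (t * u)        <⟨ ^-monoʳ-< 2 (s≤s (s≤s z≤n)) tu<2n ⟩
  2 ^ (n + n)        ≡⟨ cong (λ m → 2 ^ (n + m)) (+-identityʳ n) ⟨
  2 ^ (2 * n)        ≡⟨ ^-*-assoc 2 2 n ⟨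
  4 ^ n              ∎
  where
  open ≤-Reasoning
  sixth : ∀ u → u * u * (u * u * (u * u * 1)) ≡ u * (u * (u * (u * (u * (u * 1)))))
  sixth = solve-∀

-- Erdős: a large central binomial coefficient needs a prime factor above n, because its other
-- prime factors contribute at most (2n)^√(2n) (from the primes up to √(2n), whose powers are at
-- most 2n) times primorial (2n/3) ≤ 4^(2n/3).
module _ {n} (n≥481 : 481 ≤ n) (no-prime : ∀ {q} → Prime q → q ≤ n + n → q ≤ n) where

  private
    n>0 : 0 < n
    n>0 = ≤-trans (s≤s z≤n) n≥481

    962≤2n : 962 ≤ n + n
    962≤2n = +-mono-≤ n≥481 n≥481

    N : ℕ
    N = quotient (m!*n!∣[m+n]! n n)

    [2n]!≡ : (n + n) ! ≡ N * (n ! * n !)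
    [2n]!≡ = _∣_.equality (m!*n!∣[m+n]! n n)

    N>0 : 0 < N
    N>0 = n≢0⇒n>0 λ N≡0 →
      <⇒≢ (1≤n! (n + n)) (sym (trans [2n]!≡ (cong (_* (n ! * n !)) N≡0)))

    N∣[2n]! : N ∣ (n + n) !
    N∣[2n]! = divides (n ! * n !) (trans [2n]!≡ (*-comm N (n ! * n !)))

    prime-power≤ : ∀ {q} e → Prime q → q ^ e ∣ N → q ^ e ≤ n + n
    prime-power≤ e = central-prime^≤ e n>0 [2n]!≡

    x : ℕ
    x = (n + n) / 3

    -- A prime `q` dividing `N` is at most `n`, so it divides both factors `n !` and its cube
    -- divides `(n + n) !`. If 2n < 3q, then only q and 2q can be multiples of `q` up to 2n, which
    -- yields no cube.
    prime≤2n/3 : ∀ {q} → Prime q → q ∣ N → q ≤ x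
    prime≤2n/3 {q} q-prime q∣N =
      subst (_≤ x) (m*n/n≡m q 3) (/-monoˡ-≤ 3 (≮⇒≥ λ 2n<3q →
        prime^∤! q-prime (n + n) 2 (2<q 2n<3q) 2n<3q (subst (q ^ 3 ∣_) (sym [2n]!≡) q³∣)))
      where
      2<q : n + n < q * 3 → 2 < q
      2<q 2n<3q = ≰⇒> λ q≤2 → <⇒≱ 2n<3q (≤-trans (*-monoˡ-≤ 3 q≤2)
        (≤-trans (from-yes (6 ≤? 962)) 962≤2n))
      q∣n! : q ∣ n !
      q∣n! = ∣! {{prime⇒nonZero q-prime}}
        (no-prime q-prime (prime∣!⇒≤ (n + n) q-prime (∣-trans q∣N N∣[2n]!)))
      q³∣ : q ^ 3 ∣ N * (n ! * n !)
      q³∣ = *-pres-∣ q∣N (*-pres-∣ q∣n! (subst (_∣ n !) (sym (*-identityʳ q)) q∣n!))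

  private
    absurd : ∀ k s → 31 + k ≡ s → s * s ≤ n + n → ¬ n + n < suc s * suc s
    absurd k s 31+k≡s s²≤2n 2n<[s+1]² =
      <⇒≱ ([m^u]³<4^ {n} {n + n} {suc s} {k + 30} (<⇒≤ 2n<[s+1]²) u⁶≤2^t tu<2n)
          (^-cube-≤ n {x} {(n + n) ^ suc s} 4^n≤ (m/n*n≤m (n + n) 3))
      where
      open ≤-Reasoning
      t+1≡s : suc (k + 30) ≡ s
      t+1≡s = trans (+-comm (suc k) 30) (trans (+-suc 30 k) 31+k≡s)
      u⁶≤2^t : suc s ^ 6 ≤ 2 ^ (k + 30)
      u⁶≤2^t = sixth (trans (+-comm k 32) (cong suc 31+k≡s))
        where
        sixth : ∀ {v} → k + 32 ≡ v → v ^ 6 ≤ 2 ^ (k + 30)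
        sixth refl = sixth-power≤ k
      tu<2n : (k + 30) * suc s < n + n
      tu<2n = ≤-trans (≤-reflexive (square (k + 30) t+1≡s)) s²≤2n
        where
        expand : ∀ t → suc (t * suc (suc t)) ≡ suc t * suc t
        expand = solve-∀
        square : ∀ t {s} → suc t ≡ s → suc (t * suc s) ≡ s * s
        square t refl = expand t
      -- A prime `q` above `s` has `q * q` > 2n, so `prime-power≤` forbids its square to divide `N`.
      N≤ : N ≤ (n + n) ^ s * primorial x
      N≤ = almost-squarefree-bound (<-trans n>0 (m<m+n n n>0)) s x N N>0 prime≤2n/3 prime-power≤
        λ {q} q-prime s<q q²∣N → <⇒≱ (<-≤-trans 2n<[s+1]² (*-mono-≤ s<q s<q))
          (subst (_≤ n + n) (cong (q *_) (*-identityʳ q))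
            (prime-power≤ 2 q-prime (subst (_∣ N) (sym (cong (q *_) (*-identityʳ q))) q²∣N)))
      4^n≤2nN : ∀ {n N} → 0 < n → (n + n) ! ≡ N * (n ! * n !) → 4 ^ n ≤ (n + n) * N
      4^n≤2nN {n@(suc n′)} {N} _ eq = *-cancelʳ-≤ (4 ^ n) ((n + n) * N) (n ! * n !)
        {{m*n≢0 (n !) (n !) {{n !≢0}} {{n !≢0}}}} (begin
        4 ^ n * (n ! * n !)          ≤⟨ 4^n*n!n!≤ n′ ⟩
        (n + n) * (n + n) !          ≡⟨ cong ((n + n) *_) eq ⟩
        (n + n) * (N * (n ! * n !))  ≡⟨ *-assoc (n + n) N (n ! * n !) ⟨
        (n + n) * N * (n ! * n !)    ∎)
      4^n≤ : 4 ^ n ≤ (n + n) ^ suc s * 4 ^ x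
      4^n≤ = begin
        4 ^ n                                ≤⟨ 4^n≤2nN n>0 [2n]!≡ ⟩
        (n + n) * N                          ≤⟨ *-monoʳ-≤ (n + n) N≤ ⟩
        (n + n) * ((n + n) ^ s * primorial x) ≤⟨ *-monoʳ-≤ (n + n) (*-monoʳ-≤ ((n + n) ^ s) (primorial≤4^ x)) ⟩
        (n + n) * ((n + n) ^ s * 4 ^ x)      ≡⟨ *-assoc (n + n) ((n + n) ^ s) (4 ^ x) ⟨
        (n + n) ^ suc s * 4 ^ x              ∎

  large-prime-needed : ⊥
  large-prime-needed =
    let s , s²≤2n , 2n<[s+1]² = integer-sqrt (n + n)
        -- The hypothesis 481 ≤ n is what gives 31² = 961 ≤ 2n, and s = 31 is where `sixth-power≤`
        -- starts, with base s+1 = 32.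
        31≤s = ≮⇒≥ λ s<31 → <⇒≱ 2n<[s+1]²
          (≤-trans (*-mono-≤ s<31 s<31) (≤-trans (from-yes (961 ≤? 962)) 962≤2n))
        k , 31+k≡s = m≤n⇒∃[o]m+o≡n 31≤s
    in absurd k s 31+k≡s s²≤2n 2n<[s+1]²

-- The prime `r` serves every `n` with `q ≤ n < r`; smaller `n` are passed on to `below`.
bertrand-from : ∀ {n q r} → Prime r → r ≤ q + q →
  (n < q → ∃ λ r → Prime r × n < r × r ≤ n + n) →
  n < r → ∃ λ r → Prime r × n < r × r ≤ n + n
bertrand-from {n} {q} {r} r-prime r≤2q below n<r with n <? q
... | yes n<q = below n<q
... | no  n≮q = r , r-prime , n<r , ≤-trans r≤2q (+-mono-≤ (≮⇒≥ n≮q) (≮⇒≥ n≮q))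

bertrand : ∀ {n} → 0 < n → ∃ λ q → Prime q × n < q × q ≤ n + n
bertrand {n} 0<n with n <? 631
... | yes n<631 =
  -- In the chain 1, 2, 3, 5, 7, 13, 23, 43, 83, 163, 317, 631 each entry is at most twice the one
  -- before; 631 is the first to pass 481.
  bertrand-from {q = 317} (from-yes (prime? 631)) (from-yes (631 ≤? 634))
  (bertrand-from {q = 163} (from-yes (prime? 317)) (from-yes (317 ≤? 326))
  (bertrand-from {q = 83} (from-yes (prime? 163)) (from-yes (163 ≤? 166))
  (bertrand-from {q = 43} (from-yes (prime? 83)) (from-yes (83 ≤? 86))
  (bertrand-from {q = 23} (from-yes (prime? 43)) (from-yes (43 ≤? 46))
  (bertrand-from {q = 13} (from-yes (prime? 23)) (from-yes (23 ≤? 26))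
  (bertrand-from {q = 7} (from-yes (prime? 13)) (from-yes (13 ≤? 14))
  (bertrand-from {q = 5} (from-yes (prime? 7)) (from-yes (7 ≤? 10))
  (bertrand-from {q = 3} (from-yes (prime? 5)) (from-yes (5 ≤? 6))
  (bertrand-from {q = 2} (from-yes (prime? 3)) (from-yes (3 ≤? 4))
  (bertrand-from {q = 1} (from-yes (prime? 2)) (from-yes (2 ≤? 2))
  λ n<1 → contradiction 0<n (<⇒≱ n<1))))))))))) n<631
... | no n≮631 with nextPrime n
...   | q , (n<q , q-prime) , q-least with q ≤? n + n
...     | yes q≤2n = q , q-prime , n<q , q≤2n
...     | no  q≰2n = ⊥-elim
  (large-prime-needed (≤-trans (from-yes (481 ≤? 631)) (≮⇒≥ n≮631))
    λ r-prime r≤2n → ≮⇒≥ λ n<r → q≰2n (≤-trans (q-least _ (n<r , r-prime)) r≤2n))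

Unique-resp-↭ : ∀ {xs ys : List ℕ} → xs ↭ ys → Unique xs → Unique ys
Unique-resp-↭ = SetoidPermutation.Unique-resp-↭ (setoid ℕ) ∘ ↭⇒↭ₛ

-- Primes between two given ones

odd-prime : ∀ {q} → Prime q → 2 < q → ∃ λ m → q ≡ suc (m + m)
odd-prime {q} q-prime 2<q with even⊎odd q
... | m , inj₂ eq = m , eq
... | zero , inj₁ refl = contradiction 2<q λ ()
... | suc zero , inj₁ refl = contradiction 2<q (<-irrefl refl)
... | suc (suc m) , inj₁ refl = contradiction q-prime (¬prime-double {suc (suc m)} (s≤s (s≤s z≤n)))

odd-prime-gap : ∀ {q r} → Prime q → 2 < q → Prime r → q < r → suc q < r
odd-prime-gap q-prime 2<q r-prime q<r with odd-prime q-prime 2<q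
... | suc m , refl = ≤∧≢⇒< q<r λ { refl →
  ¬prime-double {2 + m} (s≤s (s≤s z≤n)) (subst (λ n → Prime (2 + n)) (sym (+-suc m (suc m))) r-prime) }
... | zero , refl = contradiction 2<q λ { (s≤s ()) }

-- For `c = 2`, Bertrand's postulate at `x` gives x < r ≤ 2x, and parity improves this to x+2 ≤ r ≤
-- 2x-1. For odd `c` it is applied at y = x+c-1, and parity gives r ≤ 2y-1. Then r+c ≤ 2x+3c-3 ≤
-- cx+1 ≤ q, because x ≥ c+2.
prime-between : ∀ {c x q} → Prime c → Prime x → c < x → c * x < q →
                ∃ λ r → Prime r × x + c ≤ r × r + c ≤ q
prime-between {c} {x} {q} c-prime x-prime c<x cx<q with c ≟ 2
... | yes refl with bertrand (prime>0 x-prime)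
...   | r , r-prime , x<r , r≤2x = r , r-prime ,
  subst (_≤ r) (+-comm 2 x) (odd-prime-gap x-prime c<x r-prime x<r) ,
  (begin
    r + 2        ≡⟨ +-comm r 2 ⟩
    2 + r        ≤⟨ s≤s (≤∧≢⇒< r≤2x λ { refl → ¬prime-double (prime>1 x-prime) r-prime }) ⟩
    suc (x + x)  ≡⟨ cong (λ y → suc (x + y)) (+-identityʳ x) ⟨
    suc (2 * x)  ≤⟨ cx<q ⟩
    q            ∎)
  where open ≤-Reasoning
prime-between {c} {x} {q} c-prime x-prime c<x cx<q | no c≢2
  with odd-prime c-prime 2<c | m≤n⇒∃[o]m+o≡n (odd-prime-gap c-prime 2<c x-prime c<x)
  where
  2<c : 2 < c
  2<c = ≤∧≢⇒< (prime>1 c-prime) (c≢2 ∘ sym)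
... | zero , refl | _ = contradiction c-prime ¬prime[1]
... | suc i , refl | w , refl = between (bertrand {y} (s≤s z≤n))
  where
  open ≤-Reasoning
  y : ℕ
  y = x + (suc i + suc i)
  -- The slack vanishes for `i = w = 0`, that is for `c = 3` and `x = 5`, so both the gap of 2 and
  -- the parity of `r` are used to the full.
  slack : ∀ i w → let c = suc (suc i + suc i); x = suc (suc c) + w; y = x + (suc i + suc i) in
          y + y + c + (6 * i + 4 * (i * i) + w + 2 * (i * w)) ≡ suc (suc (c * x))
  slack = solve-∀
  between : (∃ λ r → Prime r × y < r × r ≤ y + y) → ∃ λ r → Prime r × x + c ≤ r × r + c ≤ q
  between (r , r-prime , y<r , r≤2y) = r , r-prime ,
    subst (_≤ r) (sym (+-suc x (suc i + suc i))) y<r ,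
    ≤-trans (≤-pred (begin
      suc r + c            ≤⟨ +-monoˡ-≤ c (≤∧≢⇒< r≤2y λ { refl → ¬prime-double {y} (s≤s (s≤s z≤n)) r-prime }) ⟩
      y + y + c            ≤⟨ m≤m+n (y + y + c) _ ⟩
      y + y + c + _        ≡⟨ slack i w ⟩
      suc (suc (c * x))    ∎)) cx<q

-- Exchanging primes

record Improvement (n : ℕ) (qs : List ℕ) : Set where
  constructor improvement
  field
    members  : List ℕ
    primes   : All Prime members
    unique   : Unique members
    length≡  : length members ≡ suc (length qs)
    sum≤     : sum members ≤ n
    product≥ : product qs ≤ product members

∈⇒↭∷ : ∀ {x : ℕ} {xs} → x ∈ xs → ∃ λ ys → xs ↭ x ∷ ys
∈⇒↭∷ {x} x∈xs with ∈-∃++ x∈xs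
... | ys , zs , refl = ys ++ zs , shift x ys zs

split-prime : ∀ {n qs c x q} → All Prime qs → Unique qs → sum qs ≤ n →
  Prime c → Prime x → c ≢ x → c ∉ qs → x ∉ qs → q ∈ qs → x + c ≤ q → q ≤ c * x → Improvement n qs
split-prime {n} {qs} {c} {x} {q} qs-prime qs-unique Σ≤n c-prime x-prime c≢x c∉ x∉ q∈ x+c≤q q≤cx
  with ∈⇒↭∷ q∈
... | rs , qs↭ with All-resp-↭ qs↭ qs-prime | Unique-resp-↭ qs↭ qs-unique
...   | _ ∷ rs-prime | _ ∷ rs-unique = improvement (c ∷ x ∷ rs)
  (c-prime ∷ x-prime ∷ rs-prime)
  ((c≢x ∷ fresh c∉) ∷ fresh x∉ ∷ rs-unique)
  (cong suc (sym (↭-length qs↭)))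
  (begin
    c + (x + sum rs)  ≡⟨ +-assoc c x (sum rs) ⟨
    c + x + sum rs    ≤⟨ +-monoˡ-≤ (sum rs) (subst (_≤ q) (+-comm x c) x+c≤q) ⟩
    q + sum rs        ≡⟨ sum-↭ qs↭ ⟨
    sum qs            ≤⟨ Σ≤n ⟩
    n                 ∎)
  (begin
    product qs              ≡⟨ product-↭ qs↭ ⟩
    q * product rs          ≤⟨ *-monoˡ-≤ (product rs) q≤cx ⟩
    c * x * product rs      ≡⟨ *-assoc c x (product rs) ⟩
    c * (x * product rs)    ∎)
  where
  open ≤-Reasoning
  fresh : ∀ {y} → y ∉ qs → All (y ≢_) rs
  fresh y∉ = All.tabulate λ { z∈rs refl → y∉ (∈-resp-↭ (↭-sym qs↭) (there z∈rs)) }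

-- When q > c x, a prime strictly between x + c and q - c either lies in qs and can take the
-- place of q, or does not and can take the place of x.
split-distant : ∀ d {n qs c x q} → All Prime qs → Unique qs → sum qs ≤ n →
  Prime c → Prime x → c < x → c ∉ qs → x ∉ qs → q ∈ qs → x + c ≤ q → q ≤ x + d → Improvement n qs
-- The argument `d` bounds the distance from `x` to `q`, which shrinks by at least `c` in every
-- round.
split-distant zero {c = c} {x} _ _ _ c-prime _ _ _ _ _ x+c≤q q≤x =
  contradiction (≤-trans x+c≤q (subst (_ ≤_) (+-identityʳ x) q≤x)) (<⇒≱ (m<m+n x (prime>0 c-prime)))
split-distant (suc d) {n} {qs} {c} {x} {q} qs-prime qs-unique Σ≤n c-prime x-prime c<x c∉ x∉ q∈ x+c≤q q≤x+d
  with q ≤? c * x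
... | yes q≤cx = split-prime qs-prime qs-unique Σ≤n c-prime x-prime (<⇒≢ c<x) c∉ x∉ q∈ x+c≤q q≤cx
... | no  q≰cx with prime-between c-prime x-prime c<x (≰⇒> q≰cx)
...   | r , r-prime , x+c≤r , r+c≤q with r ∈? qs
...     | yes r∈ = split-distant d qs-prime qs-unique Σ≤n c-prime x-prime c<x c∉ x∉ r∈ x+c≤r
  (≤-pred (<-≤-trans (m<m+n r (prime>0 c-prime)) (≤-trans r+c≤q (≤-trans q≤x+d (≤-reflexive (+-suc x d))))))
...     | no  r∉ = split-distant d qs-prime qs-unique Σ≤n c-prime r-prime
  (<-≤-trans c<x (≤-trans (m≤m+n x c) x+c≤r)) c∉ r∉ q∈ r+c≤q
  (≤-trans q≤x+d (≤-trans (≤-reflexive (+-suc x d))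
    (+-monoˡ-≤ d (<-≤-trans (m<m+n x (prime>0 c-prime)) x+c≤r))))

-- Replace entries of bs by those of as one at a time.  Before the total decrease reaches c, the
-- product of the replaced entries has shrunk by a factor of at most (c + 1) / (c + 1 - decrease);
-- here E is c + 1 - decrease, and P and Q are the products of the entries of as and bs already
-- exchanged.  As the entries of as exceed c, the step with which the decrease reaches c costs at
-- most a further factor 2 c / (c + 1).
exchange : ∀ {c} as bs E P Q {N} → 0 < c → length as ≡ length bs → All (c <_) as →
  (∀ {a b} → a ∈ as → b ∈ bs → a ≤ b × b < a + c) →
  2 ≤ E → E ≤ suc c → Q * E ≤ suc c * P → sum bs + suc c ≤ N + E → c + sum as ≤ N →
  ∃₂ λ zs rest → as ++ bs ↭ zs ++ rest × length zs ≡ length bs × c + sum zs ≤ N ×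
                 Q * product bs ≤ c * P * product zs
-- Everything has been exchanged, so the budget comes from `c + sum as ≤ N`. In terms of the
-- unshifted c, 2Q ≤ QE ≤ (c+1)P ≤ 2cP.
exchange {suc c} [] [] E P Q _ _ _ _ 2≤E _ QE≤ _ c≤N =
  [] , [] , ↭-refl , refl , c≤N , *-monoˡ-≤ 1 (*-cancelʳ-≤ Q (suc c * P) 2 (begin
    Q * 2            ≤⟨ *-monoʳ-≤ Q 2≤E ⟩
    Q * E            ≤⟨ QE≤ ⟩
    (2 + c) * P      ≤⟨ m≤m+n ((2 + c) * P) (c * P) ⟩
    (2 + c) * P + c * P ≡⟨ double c P ⟩
    suc c * P * 2    ∎))
  where
  open ≤-Reasoning
  double : ∀ c P → (2 + c) * P + c * P ≡ suc c * P * 2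
  double = solve-∀
exchange {c} (a ∷ as) (b ∷ bs) E P Q {N} 0<c |as|≡|bs| (c<a ∷ c<as) close 2≤E E≤ QE≤ Σbs≤ Σas≤N
  with m≤n⇒∃[o]m+o≡n (proj₁ (close (here refl) (here refl)))
     | m≤n⇒∃[o]m+o≡n (≤-trans (≤-trans (m≤m+n a (sum as)) (m≤n+m (a + sum as) c)) Σas≤N)
... | d , refl | N′ , refl with d + 2 ≤? E
-- Here `d = b - a`. The new `E′ = E - d` is still at least 2, so the total decrease stays below `c`
-- and the exchange goes on with budget `N′ = N - a`.
...   | yes d+2≤E with m≤n⇒∃[o]m+o≡n (≤-trans (m≤m+n d 2) d+2≤E)
...     | E′ , refl with exchange as bs E′ (P * a) (Q * b) 0<c (suc-injective |as|≡|bs|) c<as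
                           (λ a∈ b∈ → close (there a∈) (there b∈))
                           (+-cancelˡ-≤ d 2 E′ d+2≤E) E′≤ QE′≤ Σbs′≤ Σas′≤N′
  where
  open ≤-Reasoning
  E′≤ : E′ ≤ suc c
  E′≤ = ≤-trans (m≤n+m E′ d) E≤
  -- From `E′ ≤ suc c ≤ a` follows b E′ = a E′ + d E′ ≤ a (E′ + d) = a E.
  QE′≤ : Q * b * E′ ≤ suc c * (P * a)
  QE′≤ = begin
    Q * (a + d) * E′              ≡⟨ expand Q a d E′ ⟩
    Q * (a * E′ + d * E′)         ≤⟨ *-monoʳ-≤ Q (+-monoʳ-≤ (a * E′) (*-monoʳ-≤ d (≤-trans E′≤ c<a))) ⟩
    Q * (a * E′ + d * a)          ≡⟨ factor Q a d E′ ⟩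
    Q * (d + E′) * a              ≤⟨ *-monoˡ-≤ a QE≤ ⟩
    suc c * P * a                 ≡⟨ *-assoc (suc c) P a ⟩
    suc c * (P * a)               ∎
    where
    expand : ∀ Q a d e → Q * (a + d) * e ≡ Q * (a * e + d * e)
    expand = solve-∀
    factor : ∀ Q a d e → Q * (a * e + d * a) ≡ Q * (d + e) * a
    factor = solve-∀
  Σbs′≤ : sum bs + suc c ≤ N′ + E′
  Σbs′≤ = +-cancelˡ-≤ (a + d) _ _ (begin
    a + d + (sum bs + suc c)   ≡⟨ +-assoc (a + d) (sum bs) (suc c) ⟨
    a + d + sum bs + suc c     ≤⟨ Σbs≤ ⟩
    a + N′ + (d + E′)          ≡⟨ rearrange a N′ d E′ ⟩
    a + d + (N′ + E′)          ∎)
    where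
    rearrange : ∀ a n d e → a + n + (d + e) ≡ a + d + (n + e)
    rearrange = solve-∀
  Σas′≤N′ : c + sum as ≤ N′
  Σas′≤N′ = +-cancelˡ-≤ a (c + sum as) N′ (≤-trans (≤-reflexive (rearrange a c (sum as))) Σas≤N)
    where
    rearrange : ∀ a c s → a + (c + s) ≡ c + (a + s)
    rearrange = solve-∀
...       | zs , rest , perm , |zs|≡ , Σzs≤ , Π≤ =
  a ∷ zs , b ∷ rest , prep-shift perm , cong suc |zs|≡ ,
  ≤-trans (≤-reflexive (rearrange c a (sum zs))) (+-monoʳ-≤ a Σzs≤) ,
  (begin
    Q * (b * product bs)       ≡⟨ *-assoc Q b (product bs) ⟨
    Q * b * product bs         ≤⟨ Π≤ ⟩
    c * (P * a) * product zs   ≡⟨ rearrange′ c P a (product zs) ⟩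
    c * P * (a * product zs)   ∎)
  where
  open ≤-Reasoning
  rearrange : ∀ c a s → c + (a + s) ≡ a + (c + s)
  rearrange = solve-∀
  rearrange′ : ∀ c P a z → c * (P * a) * z ≡ c * P * (a * z)
  rearrange′ = solve-∀
  prep-shift : as ++ bs ↭ zs ++ rest → a ∷ as ++ b ∷ bs ↭ a ∷ zs ++ b ∷ rest
  prep-shift p = prep a (↭-trans (shift b as bs) (↭-trans (prep b p) (↭-sym (shift b zs rest))))
exchange {suc c} (a ∷ as) (b ∷ bs) E P Q {N} 0<c |as|≡|bs| (c<a ∷ c<as) close 2≤E E≤ QE≤ Σbs≤ Σas≤N
  | d , refl | N′ , refl | no d+2≰E =
  -- Now `E ≤ suc d`, so this exchange brings the decrease to `c`: the remaining entries of `bs` are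
  -- kept and those of `as` discarded.
  a ∷ bs , b ∷ as ,
  prep a (↭-trans (shift b as bs) (↭-trans (prep b (++-comm as bs)) (↭-sym (shift b bs as)))) ,
  refl ,
  +-cancelʳ-≤ (suc d) _ _ (begin
    suc c + (a + sum bs) + suc d    ≡⟨ rearrange c a (sum bs) d ⟩
    a + d + sum bs + suc (suc c)    ≤⟨ Σbs≤ ⟩
    a + N′ + E                      ≤⟨ +-monoʳ-≤ (a + N′) (≤-pred (subst (suc E ≤_) (+-comm d 2) (≰⇒> d+2≰E))) ⟩
    a + N′ + suc d                  ∎) ,
  *-cancelʳ-≤ _ _ 2 (begin
    Q * (b * product bs) * 2            ≡⟨ rearrange′ Q b (product bs) ⟩
    Q * 2 * (b * product bs)            ≤⟨ *-monoˡ-≤ (b * product bs) (≤-trans (*-monoʳ-≤ Q 2≤E) QE≤) ⟩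
    (2 + c) * P * (b * product bs)      ≡⟨ rearrange″ (2 + c) P b (product bs) ⟩
    P * ((2 + c) * b * product bs)      ≤⟨ *-monoʳ-≤ P (*-monoˡ-≤ (product bs) [c+1]b≤2ca) ⟩
    P * (2 * suc c * a * product bs)    ≡⟨ rearrange‴ P (suc c) a (product bs) ⟩
    suc c * P * (a * product bs) * 2    ∎)
  where
  open ≤-Reasoning
  rearrange : ∀ c a s d → suc c + (a + s) + suc d ≡ a + d + s + suc (suc c)
  rearrange = solve-∀
  rearrange′ : ∀ Q b s → Q * (b * s) * 2 ≡ Q * 2 * (b * s)
  rearrange′ = solve-∀
  rearrange″ : ∀ k P b s → k * P * (b * s) ≡ P * (k * b * s)
  rearrange″ = solve-∀
  rearrange‴ : ∀ P k a s → P * (2 * k * a * s) ≡ k * P * (a * s) * 2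
  rearrange‴ = solve-∀
  d≤c : d ≤ c
  d≤c = ≤-pred (+-cancelˡ-< a d (suc c) (proj₂ (close (here refl) (here refl))))
  -- Since `d ≤ c` and `a ≥ 2 + c`, the worst ratio `b / a` occurs at `a = 2 + c`, `d = c`, where
  -- equality holds.
  [c+1]b≤2ca : (2 + c) * b ≤ 2 * suc c * a
  [c+1]b≤2ca with m≤n⇒∃[o]m+o≡n c<a
  ... | w , refl = begin
    (2 + c) * (a + d)               ≤⟨ *-monoʳ-≤ (2 + c) (+-monoʳ-≤ a d≤c) ⟩
    (2 + c) * (a + c)               ≤⟨ m≤m+n _ (w * c) ⟩
    (2 + c) * (a + c) + w * c       ≡⟨ slack c w ⟩
    2 * suc c * a                   ∎
    where
    slack : ∀ c w → let a = suc (suc c) + w in (2 + c) * (a + c) + w * c ≡ 2 * suc c * a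
    slack = solve-∀

-- Comparing a set of primes with the first primes

∉-++⁺ : ∀ {x : ℕ} {ys zs} → x ∉ ys → x ∉ zs → x ∉ ys ++ zs
∉-++⁺ x∉ys x∉zs = [ x∉ys , x∉zs ]′ ∘ ∈-++⁻ _

Unique-++⁻ : ∀ (xs : List ℕ) {ys} → Unique (xs ++ ys) → Unique xs × (∀ {x} → x ∈ xs → x ∉ ys)
Unique-++⁻ [] _ = [] , λ ()
Unique-++⁻ (x ∷ xs) (x∉ ∷ unique) with Unique-++⁻ xs unique
... | xs-unique , disjoint = All.++⁻ˡ xs x∉ ∷ xs-unique , λ
  { (here refl) x∈ys → All.lookup x∉ (∈-++⁺ʳ xs x∈ys) refl
  ; (there x∈xs) → disjoint x∈xs }

-- For lists without repetition `C` is the intersection and `A`, `B` are the two differences. Only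
-- `A#B` has to be recorded: that `C` is disjoint from `A` and from `B` follows from the uniqueness
-- of `T` and `qs`.
record Decomposition (T qs : List ℕ) : Set where
  constructor decomposition
  field
    {A B C} : List ℕ
    T↭      : T ↭ A ++ C
    qs↭     : qs ↭ B ++ C
    A#B     : ∀ {x} → x ∈ A → x ∉ B

decompose : ∀ T qs → Decomposition T qs
decompose [] qs = decomposition {A = []} {qs} {[]} ↭-refl (↭-sym (++-identityʳ qs)) λ ()
decompose (x ∷ T) qs with x ∈? qs
... | no x∉qs with decompose T qs
...   | decomposition {A} {B} {C} T↭ qs↭ A#B = decomposition {A = x ∷ A} {B} {C} (prep x T↭) qs↭ λ
  { (here refl) x∈B → x∉qs (∈-resp-↭ (↭-sym qs↭) (∈-++⁺ˡ x∈B))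
  ; (there x∈A) → A#B x∈A }
decompose (x ∷ T) qs | yes x∈qs with ∈⇒↭∷ x∈qs
...   | qs′ , qs↭qs′ with decompose T qs′
...     | decomposition {A} {B} {C} T↭ qs′↭ A#B = decomposition {A = A} {B} {x ∷ C}
  (↭-trans (prep x T↭) (↭-sym (shift x A C)))
  (↭-trans qs↭qs′ (↭-trans (prep x qs′↭) (↭-sym (shift x B C))))
  A#B

extract-min : ∀ x xs → ∃₂ λ c cs → x ∷ xs ↭ c ∷ cs × All (c ≤_) cs
extract-min x [] = x , [] , ↭-refl , []
extract-min x (y ∷ ys) with extract-min y ys
... | c , cs , perm , c≤cs with x ≤? c
...   | yes x≤c = x , c ∷ cs , prep x perm , x≤c ∷ All.map (≤-trans x≤c) c≤cs
...   | no  x≰c = c , x ∷ cs , ↭-trans (prep x perm) (swap x c ↭-refl) , <⇒≤ (≰⇒> x≰c) ∷ c≤cs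

∈-firstPrimes : ∀ {q} j → Prime q → q ≤ p j → q ∈ firstPrimes j
∈-firstPrimes zero q-prime q≤0 = contradiction (prime>0 q-prime) (≤⇒≯ q≤0)
∈-firstPrimes {q} (suc j) q-prime q≤ with q ≤? p j
... | yes q≤pj = there (∈-firstPrimes j q-prime q≤pj)
... | no  q≰pj = here (≤-antisym q≤ (proj₂ (proj₂ (nextPrime (p j))) q (≰⇒> q≰pj , q-prime)))

module FirstPrimes (m : ℕ) {qs} (qs-prime : All Prime qs) (qs-unique : Unique qs)
  (diff : Decomposition (firstPrimes m) qs) where

  open Decomposition diff public

  private
    T-unique : Unique (A ++ C)
    T-unique = Unique-resp-↭ T↭ (firstPrimes-unique m)

    qs-unique′ : Unique (B ++ C)
    qs-unique′ = Unique-resp-↭ qs↭ qs-unique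

  A∉qs : ∀ {a} → a ∈ A → a ∉ qs
  A∉qs a∈A a∈qs = ∉-++⁺ (A#B a∈A) (proj₂ (Unique-++⁻ A T-unique) a∈A) (∈-resp-↭ qs↭ a∈qs)

  B∈qs : ∀ {b} → b ∈ B → b ∈ qs
  B∈qs b∈B = ∈-resp-↭ (↭-sym qs↭) (∈-++⁺ˡ b∈B)

  A∈firstPrimes : ∀ {a} → a ∈ A → a ∈ firstPrimes m
  A∈firstPrimes a∈A = ∈-resp-↭ (↭-sym T↭) (∈-++⁺ˡ a∈A)

  -- A prime `b ≤ p m` would be among the first `m` primes, hence in `A` or `C`, and `B` is disjoint
  -- from both.
  A<B : ∀ {a b} → a ∈ A → b ∈ B → a < b
  A<B a∈A b∈B = ≤-<-trans (All.lookup (firstPrimes-≤ m) (A∈firstPrimes a∈A))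
    (≰⇒> λ b≤ → ∉-++⁺ (λ b∈A → A#B b∈A b∈B) (proj₂ (Unique-++⁻ B qs-unique′) b∈B)
      (∈-resp-↭ T↭ (∈-firstPrimes m (All.lookup qs-prime (B∈qs b∈B)) b≤)))

  A++B++C-prime : All Prime (A ++ B ++ C)
  A++B++C-prime = All.++⁺ (All.++⁻ˡ A (All-resp-↭ T↭ (firstPrimes-prime m))) (All-resp-↭ qs↭ qs-prime)

  A++B++C-unique : Unique (A ++ B ++ C)
  A++B++C-unique = Unique.++⁺ (proj₁ (Unique-++⁻ A T-unique)) qs-unique′
    λ (x∈A , x∈BC) → A∉qs x∈A (∈-resp-↭ (↭-sym qs↭) x∈BC)

  |A|+|C|≡m : length A + length C ≡ m
  |A|+|C|≡m = trans (sym (length-++ A)) (trans (sym (↭-length T↭)) (firstPrimes-length m))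

  |B|+|C|≡|qs| : length B + length C ≡ length qs
  |B|+|C|≡|qs| = trans (sym (length-++ B)) (sym (↭-length qs↭))

  ΣA+ΣC≡σ : sum A + sum C ≡ σ m
  ΣA+ΣC≡σ = trans (sym (sum-++ A C)) (trans (sym (sum-↭ T↭)) (firstPrimes-sum m))

  ΣB+ΣC≡Σqs : sum B + sum C ≡ sum qs
  ΣB+ΣC≡Σqs = trans (sym (sum-++ B C)) (sym (sum-↭ qs↭))

  ΠB*ΠC≡Πqs : product B * product C ≡ product qs
  ΠB*ΠC≡Πqs = trans (sym (product-++ B C)) (sym (product-↭ qs↭))

improve-with : ∀ {n qs} → Decomposition (firstPrimes (suc (length qs))) qs →
  All Prime qs → Unique qs → sum qs ≤ n → σ (suc (length qs)) ≤ n → Improvement n qs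
improve-with {n} {qs} diff qs-prime qs-unique Σ≤n σ≤n = from-A A ↭-refl
  where
  open FirstPrimes (suc (length qs)) qs-prime qs-unique diff
  open ≤-Reasoning

  |A|≡1+|B| : length A ≡ suc (length B)
  |A|≡1+|B| = +-cancelʳ-≡ (length C) _ _ (trans |A|+|C|≡m (cong suc (sym |B|+|C|≡|qs|)))

  from-min : ∀ {c as} → A ↭ c ∷ as → All (c ≤_) as → Improvement n qs
  from-min {c} {as} A↭ c≤as
    with All-resp-↭ (++⁺ʳ (B ++ C) A↭) A++B++C-prime | Unique-resp-↭ (++⁺ʳ (B ++ C) A↭) A++B++C-unique
  ... | all-prime@(c-prime ∷ as++B++C-prime) | all-unique@(c∉ ∷ _)
    -- If no such pair exists, then `b < a + c` throughout, which is the closeness that `exchange`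
    -- demands.
    with any? (λ a → any? (λ b → a + c ≤? b) B) as
  ...   | yes distant with find distant
  ...     | a , a∈as , distant′ with find distant′
  ...       | b , b∈B , a+c≤b = split-distant b qs-prime qs-unique Σ≤n c-prime
    (All.lookup as++B++C-prime (∈-++⁺ˡ a∈as))
    (c< a∈as) (A∉qs (∈-resp-↭ (↭-sym A↭) (here refl))) (A∉qs (∈-resp-↭ (↭-sym A↭) (there a∈as)))
    (B∈qs b∈B) a+c≤b (m≤n+m b a)
    where
    c< : ∀ {a} → a ∈ as → c < a
    c< a∈ = ≤∧≢⇒< (All.lookup c≤as a∈) (All.lookup c∉ (∈-++⁺ˡ a∈))
  from-min {c} {as} A↭ c≤as | all-prime@(c-prime ∷ _) | all-unique@(c∉ ∷ _) | no ¬distant =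
    -- Nothing has been exchanged yet: the decrease is 0 and both products are 1. The budget
    -- `n ∸ sum C` suffices for `B` because `sum qs ≤ n`, and for `A` because the sum of the first
    -- primes is at most `n`.
    exchanged (exchange as B (suc c) 1 1 {n ∸ sum C} (prime>0 c-prime) |as|≡|B|
      (All.tabulate λ a∈ → ≤∧≢⇒< (All.lookup c≤as a∈) (All.lookup c∉ (∈-++⁺ˡ a∈)))
      (λ a∈ b∈ → <⇒≤ (A<B (∈-resp-↭ (↭-sym A↭) (there a∈)) b∈) ,
                 ≰⇒> λ a+c≤b → ¬distant (lose a∈ (lose b∈ a+c≤b)))
      (s≤s (prime>0 c-prime)) ≤-refl (≤-reflexive (*-comm 1 (suc c)))
      (+-monoˡ-≤ (suc c) (m+n≤o⇒m≤o∸n (sum B) (subst (_≤ n) (sym ΣB+ΣC≡Σqs) Σ≤n)))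
      (m+n≤o⇒m≤o∸n (c + sum as) (subst (λ s → s + sum C ≤ n) (sum-↭ A↭) ΣA+ΣC≤n)))
    where
    ΣA+ΣC≤n : sum A + sum C ≤ n
    ΣA+ΣC≤n = subst (_≤ n) (sym ΣA+ΣC≡σ) σ≤n
    |as|≡|B| : length as ≡ length B
    |as|≡|B| = suc-injective (trans (sym (↭-length A↭)) |A|≡1+|B|)
    exchanged : (∃₂ λ zs rest → as ++ B ↭ zs ++ rest × length zs ≡ length B ×
                   c + sum zs ≤ n ∸ sum C × 1 * product B ≤ c * 1 * product zs) →
                Improvement n qs
    exchanged (zs , rest , perm , |zs|≡|B| , Σ≤ , Π≤) = improvement (c ∷ zs ++ C)
      (All.++⁻ˡ (c ∷ zs ++ C) (All-resp-↭ perm′ all-prime))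
      (proj₁ (Unique-++⁻ (c ∷ zs ++ C) (Unique-resp-↭ perm′ all-unique)))
      (cong suc (trans (length-++ zs) (trans (cong (_+ length C) |zs|≡|B|) |B|+|C|≡|qs|)))
      (begin
        c + sum (zs ++ C)         ≡⟨ cong (c +_) (sum-++ zs C) ⟩
        c + (sum zs + sum C)      ≡⟨ +-assoc c (sum zs) (sum C) ⟨
        c + sum zs + sum C        ≤⟨ m≤o∸n⇒m+n≤o (c + sum zs) (m+n≤o⇒n≤o (sum A) ΣA+ΣC≤n) Σ≤ ⟩
        n                         ∎)
      (begin
        product qs                          ≡⟨ ΠB*ΠC≡Πqs ⟨
        product B * product C               ≡⟨ cong (_* product C) (*-identityˡ (product B)) ⟨
        1 * product B * product C           ≤⟨ *-monoˡ-≤ (product C) Π≤ ⟩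
        c * 1 * product zs * product C      ≡⟨ rearrange c (product zs) (product C) ⟩
        c * (product zs * product C)        ≡⟨ cong (c *_) (product-++ zs C) ⟨
        c * product (zs ++ C)               ∎)
      where
      rearrange : ∀ c x y → c * 1 * x * y ≡ c * (x * y)
      rearrange = solve-∀
      -- The new list is part of a rearrangement of `A ++ B ++ C`, from which it inherits primality
      -- and distinctness.
      perm′ : c ∷ as ++ (B ++ C) ↭ (c ∷ zs ++ C) ++ rest
      perm′ = prep c (↭-trans (↭-sym (++-assoc as B C)) (↭-trans (++⁺ʳ C perm)
        (↭-trans (++-assoc zs rest C) (↭-trans (++⁺ˡ zs (++-comm rest C)) (↭-sym (++-assoc zs C rest))))))

  from-A : ∀ as → A ↭ as → Improvement n qs
  from-A [] A↭ = contradiction (trans (sym |A|≡1+|B|) (↭-length A↭)) λ ()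
  from-A (a ∷ as) A↭ with extract-min a as
  ... | c , cs , perm , c≤cs = from-min (↭-trans A↭ perm) c≤cs

improve : ∀ {n qs} → All Prime qs → Unique qs → sum qs ≤ n → σ (suc (length qs)) ≤ n →
          Improvement n qs
improve {qs = qs} = improve-with (decompose (firstPrimes (suc (length qs))) qs)

-- Reaching exactly `k` prime factors

sum-mono-≤ : ∀ as bs → length as ≡ length bs → (∀ {a b} → a ∈ as → b ∈ bs → a ≤ b) → sum as ≤ sum bs
sum-mono-≤ [] [] _ _ = z≤n
sum-mono-≤ (a ∷ as) (b ∷ bs) eq as≤bs = +-mono-≤ (as≤bs (here refl) (here refl))
  (sum-mono-≤ as bs (suc-injective eq) λ a∈ b∈ → as≤bs (there a∈) (there b∈))

-- Compared with equally many first primes, the differences `A` and `B` have the same length, and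
-- every entry of `A` lies below every entry of `B`.
σ≤sum : ∀ {qs} → All Prime qs → Unique qs → σ (length qs) ≤ sum qs
σ≤sum {qs} qs-prime qs-unique = subst₂ _≤_ ΣA+ΣC≡σ ΣB+ΣC≡Σqs
  (+-monoˡ-≤ (sum C) (sum-mono-≤ A B
    (+-cancelʳ-≡ (length C) _ _ (trans |A|+|C|≡m (sym |B|+|C|≡|qs|)))
    λ a∈ b∈ → <⇒≤ (A<B a∈ b∈)))
  where open FirstPrimes (length qs) qs-prime qs-unique (decompose (firstPrimes (length qs)) qs)

σ-mono-≤ : ∀ {i j} → i ≤ j → σ i ≤ σ j
σ-mono-≤ i≤j = go (≤⇒≤′ i≤j)
  where
  go : ∀ {i j} → i ≤′ j → σ i ≤ σ j
  go ≤′-refl = ≤-refl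
  go (≤′-step {n} i≤j) = ≤-trans (go i≤j) (<⇒≤ (σ-< n))

extend-to : ∀ d {n k qs} → All Prime qs → Unique qs → sum qs ≤ n → length qs + d ≡ k → σ k ≤ n →
  ∃ λ rs → All Prime rs × Unique rs × length rs ≡ k × sum rs ≤ n × product qs ≤ product rs
extend-to zero {qs = qs} qs-prime qs-unique Σ≤n refl _ =
  qs , qs-prime , qs-unique , sym (+-identityʳ (length qs)) , Σ≤n , ≤-refl
extend-to (suc d) {n} {k} {qs} qs-prime qs-unique Σ≤n |qs|+d≡k σ≤n
  with improve qs-prime qs-unique Σ≤n (≤-trans (σ-mono-≤ |qs|<k) σ≤n)
  where
  |qs|<k : length qs < k
  |qs|<k = subst (length qs <_) |qs|+d≡k (m<m+n (length qs) (s≤s z≤n))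
... | improvement rs rs-prime rs-unique |rs|≡ Σrs≤n Π≤
  with extend-to d rs-prime rs-unique Σrs≤n
         (trans (cong (_+ d) |rs|≡) (trans (sym (+-suc (length qs) d)) |qs|+d≡k)) σ≤n
...   | ss , ss-prime , ss-unique , |ss|≡ , Σss≤n , Π≤′ =
  ss , ss-prime , ss-unique , |ss|≡ , Σss≤n , ≤-trans Π≤ Π≤′

squarefree⇒unique : ∀ {qs} → All Prime qs → Squarefree (product qs) → Unique qs
squarefree⇒unique [] _ = []
squarefree⇒unique {q ∷ qs} (q-prime ∷ qs-prime) sf =
  All.tabulate (λ { r∈qs refl → ¬prime[1] (subst Prime (sf q (*-monoʳ-∣ q (∈⇒∣product r∈qs))) q-prime) })
  ∷ squarefree⇒unique qs-prime λ d d²∣ → sf d (∣n⇒∣m*n q d²∣)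

corollary6p1 : ∀ (n k : ℕ) → 2 ≤ n → (σk≤n : σ k ≤ n) → n < σ (suc k) →
    h n ≡ h[ k ] n σk≤n
corollary6p1 n k _ σk≤n n<σ with maximum n | maximum[ k ] n σk≤n
... | M , M-admissible , M-greatest | Mₖ , admissible sfₖ ωₖ ℓₖ , Mₖ-greatest = ≤-antisym
  (M≤Mₖ M-admissible)
  (M-greatest Mₖ (admissible sfₖ ℓₖ))
  where
  -- By `σ≤sum`, more than `k` prime factors would force `σ (suc k) ≤ n`. So `M` has `k` or fewer,
  -- and `extend-to` supplies the missing ones without lowering the product.
  M≤Mₖ : ∀ {M} → Admissible n M → M ≤ Mₖ
  M≤Mₖ {M} (admissible sf ℓ≤n) = extended (m≤n⇒∃[o]m+o≡n |qs|≤k)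
    where
    open PrimeFactorisation (factorise M) renaming (factors to qs; isFactorisation to M≡; factorsPrime to qs-prime)
    qs-unique : Unique qs
    qs-unique = squarefree⇒unique qs-prime (subst Squarefree M≡ sf)
    |qs|≤k : length qs ≤ k
    |qs|≤k = ≮⇒≥ λ k<|qs| → <⇒≱ n<σ
      (≤-trans (σ-mono-≤ k<|qs|) (≤-trans (σ≤sum qs-prime qs-unique) ℓ≤n))
    extended : (∃ λ d → length qs + d ≡ k) → M ≤ Mₖ
    extended (d , |qs|+d≡k) with extend-to d qs-prime qs-unique ℓ≤n |qs|+d≡k σk≤n
    ... | rs , rs-prime , rs-unique , |rs|≡k , Σrs≤n , Π≤ with product-admissible rs-prime rs-unique
    ...   | admissible sf′ ω≡ ℓ≤ = subst (_≤ Mₖ) (sym M≡) (≤-trans Π≤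
      (Mₖ-greatest (product rs) (admissible sf′ (trans ω≡ |rs|≡k) (≤-trans ℓ≤ Σrs≤n))))
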